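{- Let $Q$ be a finite non-empty graded poset of rank $r$ with $|Q|=d$. Let $e(Q)$ denote the number of linear extensions of $Q$ and $\Omega(Q,k)$ its order polynomial. Then $$(r+2)^d\,e(Q)=\sum_{m=0}^{n}(-1)^{n+m}\left(\binom{d}{n-m}+(-1)^{d-1}\binom{d}{n+m+1}\right)\Omega(Q,m(r+2)+1),$$ where $n:=\lfloor d/2\rfloor$.
   Context: $C_k$ denotes the chain with $k$ elements. $\Omega(Q,k)$ is the order polynomial of $Q$: for positive integers $k$ it is the number of order-preserving maps $f:Q\to C_k$ (i.e. $x\le y$ implies $f(x)\le f(y)$). A linear extension of $Q$ is a bijective order-preserving map $Q\to C_d$. The poset $Q$ is graded of rank $r$ if all maximal chains of $Q$ have the same length $r$, where the length of a chain is its number of elements minus one. -}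

module Defs where

open import Level using (Level; _⊔_) renaming (suc to lsuc)
open import Data.Nat using (ℕ; suc; _^_; _∸_)
open import Data.Fin as Fin using (Fin; finToFun)
import Data.Fin.Properties as Fin
open import Data.Fin.Subset using (Subset; _∈_; _⊆_; ∣_∣)
open import Data.List using (List; length; filter; map; allFin)
open import Data.Integer.Properties using (+-0-commutativeMonoid)
open import Data.Product using (_×_; _,_)
open import Data.Sum using (_⊎_)
open import Function.Bundles using (Func; Inverse)
open import Function.Definitions using (Bijective; Injective; Surjective)
open import Relation.Binary.Bundles using (DecPoset)
open import Relation.Binary.Core using (_Preserves_⟶_)
open import Relation.Binary.PropositionalEquality
  using (_≡_; sym; trans; cong; subst₂; setoid)
open import Relation.Nullary using (Dec)
open import Relation.Nullary.Decidable using (map′; _→-dec_; _×-dec_)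

open import Algebra.Properties.CommutativeMonoid.Sum +-0-commutativeMonoid public
  using (sum-syntax)

record FinitePoset (c ℓ₁ ℓ₂ : Level) : Set (lsuc (c ⊔ ℓ₁ ⊔ ℓ₂)) where
  field
    decPoset    : DecPoset c ℓ₁ ℓ₂
    size        : ℕ
    enumeration : Inverse (DecPoset.Eq.setoid decPoset) (setoid (Fin size))

  open DecPoset decPoset public hiding (refl; trans)
  open Inverse enumeration public
    using () renaming (to to index; from to element; to-cong to index-cong)

  element-index : ∀ x → element (index x) ≈ x
  element-index = Inverse.strictlyInverseʳ enumeration

  index-element : ∀ i → index (element i) ≡ i
  index-element = Inverse.strictlyInverseˡ enumeration

module _ {c ℓ₁ ℓ₂ : Level} (Q : FinitePoset c ℓ₁ ℓ₂) where

  open FinitePoset Q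

  -- A subset of Q is given by the indices of its elements.

  IsChain : Subset size → Set ℓ₂
  IsChain S = ∀ {i j} → i ∈ S → j ∈ S →
              element i ≤ element j ⊎ element j ≤ element i

  IsMaximalChain : Subset size → Set ℓ₂
  IsMaximalChain S = IsChain S × (∀ T → IsChain T → S ⊆ T → T ⊆ S)

  -- Truncated subtraction only matters for the empty chain, which is not
  -- maximal in a non-empty poset.
  chainLength : Subset size → ℕ
  chainLength S = ∣ S ∣ ∸ 1

  IsGradedOfRank : ℕ → Set ℓ₂
  IsGradedOfRank r = ∀ S → IsMaximalChain S → chainLength S ≡ r

  -- The chain with k elements is Fin k with its usual order; maps into it
  -- respect the equality of Q.
  MapToChain : ℕ → Set (c ⊔ ℓ₁)
  MapToChain k = Func Eq.setoid (setoid (Fin k))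

  OrderPreserving : ∀ {k} → MapToChain k → Set (c ⊔ ℓ₂)
  OrderPreserving f = Func.to f Preserves _≤_ ⟶ Fin._≤_

  IsLinearExtension : MapToChain size → Set (c ⊔ ℓ₁ ⊔ ℓ₂)
  IsLinearExtension f = Bijective _≈_ _≡_ (Func.to f) × OrderPreserving f

  -- Each map Q → Fin k occurs exactly once up to pointwise equality, since
  -- finToFun is a bijection from Fin (k ^ size) onto Fin size → Fin k.
  allMaps : ∀ k → List (MapToChain k)
  allMaps k = map toMap (allFin (k ^ size))
    where
    toMap : Fin (k ^ size) → MapToChain k
    toMap t = record
      { to   = λ x → finToFun t (index x)
      ; cong = λ x≈y → cong (finToFun t) (index-cong x≈y)
      }

  orderPreserving? : ∀ {k} (f : MapToChain k) → Dec (OrderPreserving f)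
  orderPreserving? f = map′
    (λ mono {x} {y} x≤y → subst₂ Fin._≤_
      (Func.cong f (element-index x)) (Func.cong f (element-index y))
      (mono (index x) (index y)
        (≤-respˡ-≈ (Eq.sym (element-index x))
          (≤-respʳ-≈ (Eq.sym (element-index y)) x≤y))))
    (λ mono i j → mono)
    (Fin.all? λ i → Fin.all? λ j →
      (element i ≤? element j) →-dec
      (Func.to f (element i) Fin.≤? Func.to f (element j)))

  bijective? : ∀ {k} (f : MapToChain k) → Dec (Bijective _≈_ _≡_ (Func.to f))
  bijective? f = injective? ×-dec surjective?
    where
    injective? : Dec (Injective _≈_ _≡_ (Func.to f))
    injective? = map′
      (λ inj {x} {y} fx≡fy → Eq.trans (Eq.sym (element-index x))
        (Eq.trans
          (inj (index x) (index y)
            (trans (Func.cong f (element-index x))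
              (trans fx≡fy (sym (Func.cong f (element-index y))))))
          (element-index y)))
      (λ inj i j → inj)
      (Fin.all? λ i → Fin.all? λ j →
        (Func.to f (element i) Fin.≟ Func.to f (element j)) →-dec
        (element i ≟ element j))
    surjective? : Dec (Surjective _≈_ _≡_ (Func.to f))
    surjective? = Fin.all? λ y → map′
      (λ (i , fi≡y) → element i , λ z≈ → trans (Func.cong f z≈) fi≡y)
      (λ (x , fx≡y) → index x , fx≡y (element-index x))
      (Fin.any? λ i → Func.to f (element i) Fin.≟ y)

  isLinearExtension? : ∀ f → Dec (IsLinearExtension f)
  isLinearExtension? f = bijective? f ×-dec orderPreserving? f

  #linearExtensions : ℕ
  #linearExtensions = length (filter isLinearExtension? (allMaps size))

  -- Agrees with the order polynomial at positive integers k; its values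
  -- elsewhere play no role.
  orderPolynomial : ℕ → ℕ
  orderPolynomial k = length (filter orderPreserving? (allMaps k))

{-# OPTIONS --safe #-}

-- Count, for every up-set V of Q, the order-preserving maps V → C_k.  Removing
-- the elements of least value gives Ω_V(k) = Σ_{W ⊆ V} Ω_W(k - 1), the sum over
-- up-sets W.  Put Ω_V(-k) = (-1)^|V| (number of strict maps V → C_k); the
-- same recursion then holds at all integers, because a strict map also forces
-- V ∖ W to be an antichain, and the resulting alternating sums are killed by
-- toggling a maximal element.  Hence the backward difference of Ω_V is the sum
-- of Ω_W(k - 1) over proper W, and iterating it d times from Q counts maximal
-- chains of up-sets, so it is the constant e(Q).  With step r + 2 it is the
-- constant (r + 2)^d e(Q), whose binomial expansion is the theorem once the
-- values at negative integers are rewritten: since Q is graded, subtracting the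
-- rank turns strict maps into C_{k + r} into weak maps into C_k.
module Submission where

open import Defs
open import Data.Bool using (if_then_else_)
import Data.Bool.Properties as Bool
open import Data.Fin as Fin using (Fin; zero; suc; toℕ; finToFun; combine; punchOut; _↑ˡ_; _↑ʳ_)
open import Data.Fin.Induction using (po-noetherian; po-wellFounded)
import Data.Fin.Properties as Fin
open import Data.Fin.Subset
  using (Subset; Side; inside; outside; ⁅_⁆; _∪_; _⊆_; _⊂_; _∈_; _∉_; ∣_∣; ⊤)
open import Data.Fin.Subset.Properties
open import Data.Integer as ℤ using (ℤ; +_; -[1+_]; 0ℤ; 1ℤ; -1ℤ)
open import Data.Integer.Properties using (+-0-commutativeMonoid; +-*-semiring)
open import Data.List as List using (length; filter; allFin)
import Data.List.Properties as List
open import Data.Nat as ℕ using (ℕ; zero; suc; pred; NonZero; ⌊_/2⌋; _∸_; z≤n; s≤s)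
open import Data.Nat.Combinatorics using (_C_; nCk+nC[k+1]≡[n+1]C[k+1]; k>n⇒nCk≡0)
import Data.Nat.Properties as ℕ
open import Data.Nat.Tactic.RingSolver using () renaming (solve-∀ to solveℕ-∀)
open import Data.Product using (_×_; _,_; proj₁; proj₂; ∃-syntax)
open import Data.Sum using (_⊎_; inj₁; inj₂; [_,_]′)
import Data.Unit as Unit
open import Data.Vec as Vec using (Vec; []; _∷_; lookup; map; zipWith; tabulate; _[_]≔_; here; there)
import Data.Vec.Properties as Vec
import Algebra.Properties.CommutativeMonoid.Sum +-0-commutativeMonoid as Sum
import Algebra.Properties.Semiring.Sum +-*-semiring as SemiringSum
open import Function using (_∘_; id; flip; case_of_)
open import Function.Definitions using (Bijective; Injective)
open import Induction.WellFounded using (Acc; acc)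
open import Level using (Level)
open import Relation.Binary using (Rel; DecPoset; IsPartialOrder; DecidableEquality)
  renaming (Decidable to Decidable₂)
import Relation.Binary.Construct.Flip.EqAndOrd as Flip
open import Relation.Binary.PropositionalEquality
open import Relation.Nullary using (Dec; yes; no; does; ¬_; contradiction; _×-dec_; _→-dec_; ¬?)
open import Relation.Unary using (Pred; Decidable)

module _ where
  open import Data.Integer using (-_; _+_; _-_; _*_; _^_)
  open import Data.Integer.Properties
  open import Data.Integer.Tactic.RingSolver using (solve-∀)
  open ≡-Reasoning

  -- Finite differences

  Σ< : ℕ → (ℕ → ℤ) → ℤ
  Σ< n f = ∑[ i < n ] f (toℕ i)

  Σ<-cong : ∀ n {f g : ℕ → ℤ} → (∀ i → i ℕ.< n → f i ≡ g i) → Σ< n f ≡ Σ< n g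
  Σ<-cong n eq = Sum.sum-cong-≗ {n} (λ i → eq (toℕ i) (Fin.toℕ<n i))

  Σ<-zero : ∀ n {f : ℕ → ℤ} → (∀ i → i ℕ.< n → f i ≡ 0ℤ) → Σ< n f ≡ 0ℤ
  Σ<-zero n eq = trans (Σ<-cong n eq) (Sum.sum-replicate-zero n)

  Σ<-+ : ∀ n f g → Σ< n (λ i → f i + g i) ≡ Σ< n f + Σ< n g
  Σ<-+ n f g = Sum.∑-distrib-+ {n} (f ∘ toℕ) (g ∘ toℕ)

  Σ<-*ˡ : ∀ n c f → Σ< n (λ i → c * f i) ≡ c * Σ< n f
  Σ<-*ˡ n c f = sym (SemiringSum.*-distribˡ-sum {n} c (f ∘ toℕ))

  Σ<-split : ∀ m n f → Σ< (m ℕ.+ n) f ≡ Σ< m f + Σ< n (λ i → f (m ℕ.+ i))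
  Σ<-split zero    n f = sym (+-identityˡ _)
  Σ<-split (suc m) n f = trans (cong (_+_ (f 0)) (Σ<-split m n (f ∘ suc))) (sym (+-assoc (f 0) _ _))

  Σ<-last : ∀ n f → Σ< (suc n) f ≡ Σ< n f + f n
  Σ<-last zero    f = +-comm (f 0) 0ℤ
  Σ<-last (suc n) f = trans (cong (_+_ (f 0)) (Σ<-last n (f ∘ suc))) (sym (+-assoc (f 0) _ _))

  Σ<-reverse : ∀ n f → Σ< (suc n) f ≡ Σ< (suc n) (λ i → f (n ∸ i))
  Σ<-reverse zero    f = refl
  Σ<-reverse (suc n) f = begin
    Σ< (suc (suc n)) f                              ≡⟨ Σ<-last (suc n) f ⟩
    Σ< (suc n) f + f (suc n)                        ≡⟨ cong (_+ f (suc n)) (Σ<-reverse n f) ⟩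
    Σ< (suc n) (λ i → f (n ∸ i)) + f (suc n)        ≡⟨ +-comm _ (f (suc n)) ⟩
    f (suc n) + Σ< (suc n) (λ i → f (n ∸ i))        ∎

  ∇ : ℤ → (ℤ → ℤ) → ℤ → ℤ
  ∇ h G z = G z - G (z - h)

  ∇^ : ℕ → ℤ → (ℤ → ℤ) → ℤ → ℤ
  ∇^ zero    h G = G
  ∇^ (suc d) h G = ∇ h (∇^ d h G)

  ∇^-cong : ∀ d h {G H} → (∀ z → G z ≡ H z) → ∀ z → ∇^ d h G z ≡ ∇^ d h H z
  ∇^-cong zero    h eq z = eq z
  ∇^-cong (suc d) h eq z = cong₂ _-_ (∇^-cong d h eq z) (∇^-cong d h eq (z - h))

  swap-middle : ∀ a b c d → a - b - (c - d) ≡ a - c - (b - d)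
  swap-middle = solve-∀

  swap-last : ∀ a b c → a - b - c ≡ a - c - b
  swap-last = solve-∀

  -- Both operators are combinations of translations, and translations commute.
  ∇^-∇ : ∀ d h k G z → ∇^ d h (∇ k G) z ≡ ∇ k (∇^ d h G) z
  ∇^-∇ zero    h k G z = refl
  ∇^-∇ (suc d) h k G z = begin
    ∇^ d h (∇ k G) z - ∇^ d h (∇ k G) (z - h)  ≡⟨ cong₂ _-_ (∇^-∇ d h k G z) (∇^-∇ d h k G (z - h)) ⟩
    A z - A (z - k) - (A (z - h) - A (z - h - k)) ≡⟨ cong (λ y → A z - A (z - k) - (A (z - h) - A y)) (swap-last z h k) ⟩
    A z - A (z - k) - (A (z - h) - A (z - k - h)) ≡⟨ swap-middle (A z) _ _ _ ⟩
    A z - A (z - h) - (A (z - k) - A (z - k - h)) ∎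
    where A = ∇^ d h G

  ∇-telescope : ∀ A c → (∀ z → ∇ 1ℤ A z ≡ c) → ∀ s z → ∇ (+ s) A z ≡ + s * c
  ∇-telescope A c eq zero z = trans (cong (λ y → A z - A y) (+-identityʳ z)) (+-inverseʳ (A z))
  ∇-telescope A c eq (suc s) z = begin
    A z - A (z - + suc s)                              ≡⟨ cong (λ y → A z - A y) (assoc-minus z (+ s)) ⟩
    A z - A (z - 1ℤ - + s)                             ≡⟨ telescope (A z) (A (z - 1ℤ)) _ ⟩
    A z - A (z - 1ℤ) + (A (z - 1ℤ) - A (z - 1ℤ - + s)) ≡⟨ cong₂ _+_ (eq z) (∇-telescope A c eq s (z - 1ℤ)) ⟩
    c + + s * c                                        ≡⟨ suc-* (+ s) c ⟨
    + suc s * c                                        ∎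
    where
    assoc-minus : ∀ z s → z - (1ℤ + s) ≡ z - 1ℤ - s
    assoc-minus = solve-∀
    telescope : ∀ a b c → a - c ≡ a - b + (b - c)
    telescope = solve-∀

  -- Unit steps are exchanged for steps of length s one at a time. Since differences commute, the
  -- unit differences of `∇ (+ s) G` come from telescoping those of `G`, and each exchange
  -- contributes a factor s.
  ∇^-step : ∀ d G c → (∀ z → ∇^ d 1ℤ G z ≡ c) → ∀ s z → ∇^ d (+ s) G z ≡ (+ s) ^ d * c
  ∇^-step zero    G c eq s z = trans (eq z) (sym (*-identityˡ c))
  ∇^-step (suc d) G c eq s z = begin
    ∇^ (suc d) (+ s) G z       ≡⟨ ∇^-∇ d (+ s) (+ s) G z ⟨
    ∇^ d (+ s) (∇ (+ s) G) z   ≡⟨ ∇^-step d (∇ (+ s) G) (+ s * c) step s z ⟩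
    (+ s) ^ d * (+ s * c)      ≡⟨ *-assoc ((+ s) ^ d) (+ s) c ⟨
    (+ s) ^ d * + s * c        ≡⟨ cong (_* c) (*-comm ((+ s) ^ d) (+ s)) ⟩
    (+ s) ^ suc d * c          ∎
    where
    step : ∀ y → ∇^ d 1ℤ (∇ (+ s) G) y ≡ + s * c
    step y = trans (∇^-∇ d 1ℤ (+ s) G y) (∇-telescope (∇^ d 1ℤ G) c eq s y)

  -- Induction by Pascal's rule. The bound N may exceed d + 1, because the binomials beyond d
  -- vanish; this allows an even number of terms whatever the parity of d.
  ∇^-expand : ∀ d h G z N → d ℕ.< N →
    ∇^ d h G z ≡ Σ< N (λ j → -1ℤ ^ j * + (d C j) * G (z - + j * h))
  ∇^-expand zero h G z (suc N) _ = sym (begin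
    1ℤ * G (z - 0ℤ * h) + Σ< N (λ j → -1ℤ ^ suc j * + (0 C suc j) * G (z - + suc j * h))
      ≡⟨ cong₂ _+_ (trans (*-identityˡ (G (z - 0ℤ * h))) (cong G (minus-zero z h))) (Σ<-zero N vanish) ⟩
    G z + 0ℤ  ≡⟨ +-identityʳ (G z) ⟩
    G z       ∎)
    where
    minus-zero : ∀ z h → z - 0ℤ * h ≡ z
    minus-zero = solve-∀
    vanish : ∀ j → j ℕ.< N → -1ℤ ^ suc j * + (0 C suc j) * G (z - + suc j * h) ≡ 0ℤ
    vanish j _ rewrite k>n⇒nCk≡0 {0} {suc j} (s≤s z≤n) =
      cong (_* G (z - + suc j * h)) (*-zeroʳ (-1ℤ ^ suc j))
  ∇^-expand (suc d) h G z (suc N) (s≤s d<N) = begin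
    -- The first sum takes one term more than the second, so that after its term j = 0 is split off
    -- the two run in parallel.
    ∇^ d h G z - ∇^ d h G (z - h)
      ≡⟨ cong₂ _-_ (∇^-expand d h G z (suc N) (ℕ.m<n⇒m<1+n d<N)) (∇^-expand d h G (z - h) N d<N) ⟩
    term d z 0 + Σ< N (λ j → term d z (suc j)) - Σ< N (term d (z - h))
      ≡⟨ +-assoc (term d z 0) _ _ ⟩
    term d z 0 + (Σ< N (λ j → term d z (suc j)) - Σ< N (term d (z - h)))
      ≡⟨ cong (λ y → term d z 0 + (Σ< N (λ j → term d z (suc j)) + y)) neg-sum ⟩
    term (suc d) z 0 + (Σ< N (λ j → term d z (suc j)) + Σ< N (λ j → -1ℤ * term d (z - h) j))
      ≡⟨ cong (_+_ (term (suc d) z 0)) (Σ<-+ N (λ j → term d z (suc j)) (λ j → -1ℤ * term d (z - h) j)) ⟨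
    term (suc d) z 0 + Σ< N (λ j → term d z (suc j) + -1ℤ * term d (z - h) j)
      ≡⟨ cong (_+_ (term (suc d) z 0)) (Σ<-cong N λ j _ → pascal j) ⟩
    Σ< (suc N) (term (suc d) z) ∎
    where
    term : ℕ → ℤ → ℕ → ℤ
    term d z j = -1ℤ ^ j * + (d C j) * G (z - + j * h)
    neg-sum : - Σ< N (term d (z - h)) ≡ Σ< N (λ j → -1ℤ * term d (z - h) j)
    neg-sum = trans (sym (-1*i≡-i _)) (sym (Σ<-*ˡ N -1ℤ (term d (z - h))))
    shift : ∀ z h j → z - h - j * h ≡ z - (1ℤ + j) * h
    shift = solve-∀
    merge : ∀ e a b g → -1ℤ * e * b * g + -1ℤ * (e * a * g) ≡ -1ℤ * e * (a + b) * g
    merge = solve-∀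
    pascal : ∀ j → term d z (suc j) + -1ℤ * term d (z - h) j ≡ term (suc d) z (suc j)
    pascal j = begin
      term d z (suc j) + -1ℤ * term d (z - h) j
        ≡⟨ cong (λ y → term d z (suc j) + -1ℤ * (-1ℤ ^ j * + (d C j) * G y)) (shift z h (+ j)) ⟩
      term d z (suc j) + -1ℤ * (-1ℤ ^ j * + (d C j) * G (z - + suc j * h))
        ≡⟨ merge (-1ℤ ^ j) (+ (d C j)) (+ (d C suc j)) (G (z - + suc j * h)) ⟩
      -1ℤ ^ suc j * (+ (d C j ℕ.+ d C suc j)) * G (z - + suc j * h)
        ≡⟨ cong (λ c → -1ℤ ^ suc j * + c * G (z - + suc j * h)) (nCk+nC[k+1]≡[n+1]C[k+1] d j) ⟩
      term (suc d) z (suc j) ∎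

  -- Signs and the folding of the binomial expansion

  -1^-even : ∀ m → -1ℤ ^ (m ℕ.+ m) ≡ 1ℤ
  -1^-even zero    = refl
  -1^-even (suc m) rewrite ℕ.+-suc m m = trans (cancel (-1ℤ ^ (m ℕ.+ m))) (-1^-even m)
    where
    cancel : ∀ a → -1ℤ * (-1ℤ * a) ≡ a
    cancel = solve-∀

  -1^-∸ : ∀ {m n} → m ℕ.≤ n → -1ℤ ^ (n ∸ m) ≡ -1ℤ ^ (n ℕ.+ m)
  -1^-∸ {m} {n} m≤n = begin
    -1ℤ ^ (n ∸ m)                        ≡⟨ *-identityʳ _ ⟨
    -1ℤ ^ (n ∸ m) * 1ℤ                   ≡⟨ cong (_*_ (-1ℤ ^ (n ∸ m))) (-1^-even m) ⟨
    -1ℤ ^ (n ∸ m) * -1ℤ ^ (m ℕ.+ m)      ≡⟨ ^-distribˡ-+-* -1ℤ (n ∸ m) (m ℕ.+ m) ⟨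
    -1ℤ ^ (n ∸ m ℕ.+ (m ℕ.+ m))          ≡⟨ cong (_^_ -1ℤ) (ℕ.+-assoc (n ∸ m) m m) ⟨
    -1ℤ ^ (n ∸ m ℕ.+ m ℕ.+ m)            ≡⟨ cong (λ k → -1ℤ ^ (k ℕ.+ m)) (ℕ.m∸n+n≡m m≤n) ⟩
    -1ℤ ^ (n ℕ.+ m)                      ∎

  2n+2>d : ∀ d → d ℕ.< suc ℕ.⌊ d /2⌋ ℕ.+ suc ℕ.⌊ d /2⌋
  2n+2>d zero          = s≤s z≤n
  2n+2>d (suc zero)    = s≤s (s≤s z≤n)
  2n+2>d (suc (suc d)) = s≤s (s≤s (subst (suc d ℕ.≤_) (sym (ℕ.+-suc ℕ.⌊ d /2⌋ (suc ℕ.⌊ d /2⌋))) (2n+2>d d)))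

  -- The hypotheses make m ↦ F (m s + 1) symmetric, up to sign, under m ↦ -1 - m;
  -- this folds the binomial expansion of the difference onto 0 ≤ m ≤ n.
  symmetric-difference : ∀ d .{{_ : ℕ.NonZero d}} s F (p : ℕ → ℤ) →
    (∀ m → F (+ (m ℕ.* s ℕ.+ 1)) ≡ p m) →
    (∀ m → F (1ℤ - + (suc m ℕ.* s)) ≡ -1ℤ ^ d * p m) →
    let n = ℕ.⌊ d /2⌋ in
    ∇^ d (+ s) F (+ (n ℕ.* s ℕ.+ 1)) ≡
      ∑[ i < suc n ] (let m = toℕ i in
        -1ℤ ^ (n ℕ.+ m) * (+ (d C (n ∸ m)) + -1ℤ ^ (d ∸ 1) * + (d C (n ℕ.+ m ℕ.+ 1))) * p m)
  symmetric-difference d@(suc d-1) s F p right left = begin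
    ∇^ d (+ s) F z                                      ≡⟨ ∇^-expand d (+ s) F z (suc n ℕ.+ suc n) (2n+2>d d) ⟩
    -- The lower half, reversed to j = n - m, evaluates `F` at m s + 1; the upper half, j = n + 1 +
    -- m, evaluates it at 1 - (m + 1) s.
    Σ< (suc n ℕ.+ suc n) term                           ≡⟨ Σ<-split (suc n) (suc n) term ⟩
    Σ< (suc n) term + Σ< (suc n) (λ m → term (suc n ℕ.+ m))
      ≡⟨ cong (_+ Σ< (suc n) (λ m → term (suc n ℕ.+ m))) (Σ<-reverse n term) ⟩
    Σ< (suc n) (λ m → term (n ∸ m)) + Σ< (suc n) (λ m → term (suc n ℕ.+ m))
      ≡⟨ Σ<-+ (suc n) (λ m → term (n ∸ m)) (λ m → term (suc n ℕ.+ m)) ⟨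
    Σ< (suc n) (λ m → term (n ∸ m) + term (suc n ℕ.+ m))
      ≡⟨ Σ<-cong (suc n) (λ m m<1+n → collect m (ℕ.≤-pred m<1+n)) ⟩
    Σ< (suc n) (λ m → -1ℤ ^ (n ℕ.+ m) * (+ (d C (n ∸ m)) + -1ℤ ^ (d ∸ 1) * + (d C (n ℕ.+ m ℕ.+ 1))) * p m) ∎
    where
    n = ℕ.⌊ d /2⌋
    z = + (n ℕ.* s ℕ.+ 1)
    term : ℕ → ℤ
    term j = -1ℤ ^ j * + (d C j) * F (z - + j * + s)
    z≡ : z ≡ + n * + s + 1ℤ
    z≡ = cong (_+ 1ℤ) (pos-* n s)
    low : ∀ {m} → m ℕ.≤ n → z - + (n ∸ m) * + s ≡ + (m ℕ.* s ℕ.+ 1)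
    low {m} m≤n = begin
      z - + (n ∸ m) * + s                    ≡⟨ cong₂ (λ x y → x - y * + s) z≡ (trans (sym (⊖-≥ m≤n)) (sym (m-n≡m⊖n n m))) ⟩
      + n * + s + 1ℤ - (+ n - + m) * + s     ≡⟨ ring (+ n) (+ m) (+ s) ⟩
      + m * + s + 1ℤ                         ≡⟨ cong (_+ 1ℤ) (pos-* m s) ⟨
      + (m ℕ.* s ℕ.+ 1)                      ∎
      where
      ring : ∀ n m s → n * s + 1ℤ - (n - m) * s ≡ m * s + 1ℤ
      ring = solve-∀
    high : ∀ m → z - + (suc n ℕ.+ m) * + s ≡ 1ℤ - + (suc m ℕ.* s)
    high m = begin
      z - + (suc n ℕ.+ m) * + s                           ≡⟨ cong (λ x → x - + (suc n ℕ.+ m) * + s) z≡ ⟩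
      + n * + s + 1ℤ - (1ℤ + + n + + m) * + s             ≡⟨ ring (+ n) (+ m) (+ s) ⟩
      1ℤ - (1ℤ + + m) * + s                               ≡⟨ cong (λ x → 1ℤ - x) (pos-* (suc m) s) ⟨
      1ℤ - + (suc m ℕ.* s)                                ∎
      where
      ring : ∀ n m s → n * s + 1ℤ - (1ℤ + n + m) * s ≡ 1ℤ - (1ℤ + m) * s
      ring = solve-∀
    -- The extra sign of the term j = n + 1 + m cancels one factor of (-1)^d, which leaves (-1)^(d -
    -- 1).
    ring : ∀ e b b′ f p → e * b * p + -1ℤ * e * b′ * (-1ℤ * f * p) ≡ e * (b + f * b′) * p
    ring = solve-∀
    collect : ∀ m → m ℕ.≤ n → term (n ∸ m) + term (suc n ℕ.+ m) ≡
      -1ℤ ^ (n ℕ.+ m) * (+ (d C (n ∸ m)) + -1ℤ ^ (d ∸ 1) * + (d C (n ℕ.+ m ℕ.+ 1))) * p m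
    collect m m≤n = begin
      term (n ∸ m) + term (suc n ℕ.+ m)
        ≡⟨ cong₂ (λ x y → -1ℤ ^ (n ∸ m) * + (d C (n ∸ m)) * x + -1ℤ ^ (suc n ℕ.+ m) * + (d C (suc n ℕ.+ m)) * y)
             (trans (cong F (low m≤n)) (right m)) (trans (cong F (high m)) (left m)) ⟩
      -1ℤ ^ (n ∸ m) * + (d C (n ∸ m)) * p m + -1ℤ ^ (suc n ℕ.+ m) * + (d C (suc n ℕ.+ m)) * (-1ℤ ^ d * p m)
        ≡⟨ cong₂ (λ x y → x * + (d C (n ∸ m)) * p m + -1ℤ ^ (suc n ℕ.+ m) * + (d C y) * (-1ℤ ^ d * p m))
             (-1^-∸ m≤n) (ℕ.+-comm 1 (n ℕ.+ m)) ⟩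
      -1ℤ ^ (n ℕ.+ m) * + (d C (n ∸ m)) * p m + -1ℤ ^ (suc n ℕ.+ m) * + (d C (n ℕ.+ m ℕ.+ 1)) * (-1ℤ ^ d * p m)
        ≡⟨ ring (-1ℤ ^ (n ℕ.+ m)) (+ (d C (n ∸ m))) (+ (d C (n ℕ.+ m ℕ.+ 1))) (-1ℤ ^ d-1) (p m) ⟩
      _ ∎

  -- Sums over subsets and boxes

  private variable
    a p : Level
    A B : Set a
    n : ℕ

  𝟙 : Dec A → ℤ
  𝟙 A? = if does A? then 1ℤ else 0ℤ

  𝟙-yes : (A? : Dec A) → A → 𝟙 A? ≡ 1ℤ
  𝟙-yes (yes _) _ = refl
  𝟙-yes (no ¬a) a = contradiction a ¬a

  𝟙-no : (A? : Dec A) → ¬ A → 𝟙 A? ≡ 0ℤ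
  𝟙-no (yes a) ¬a = contradiction a ¬a
  𝟙-no (no _)  _  = refl

  𝟙-cong : (A? : Dec A) (B? : Dec B) → (A → B) → (B → A) → 𝟙 A? ≡ 𝟙 B?
  𝟙-cong (yes a) B? f g = sym (𝟙-yes B? (f a))
  𝟙-cong (no ¬a) B? f g = sym (𝟙-no B? (¬a ∘ g))

  𝟙-× : (A? : Dec A) (B? : Dec B) → 𝟙 (A? ×-dec B?) ≡ 𝟙 A? * 𝟙 B?
  𝟙-× (yes _) (yes _) = refl
  𝟙-× (yes _) (no _)  = refl
  𝟙-× (no _)  _       = refl

  length-filter-tabulate : ∀ {P : Pred A p} (P? : Decidable P) {N} (f : Fin N → A) →
    + length (filter P? (List.tabulate f)) ≡ ∑[ t < N ] 𝟙 (P? (f t))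
  length-filter-tabulate P? {zero}  f = refl
  length-filter-tabulate P? {suc N} f with P? (f zero)
  ... | yes _ = cong (_+_ 1ℤ) (length-filter-tabulate P? (f ∘ suc))
  ... | no  _ = trans (length-filter-tabulate P? (f ∘ suc)) (sym (+-identityˡ _))

  length-filter-map : ∀ {P : Pred A p} (P? : Decidable P) {N} (f : Fin N → A) →
    + length (filter P? (List.map f (allFin N))) ≡ ∑[ t < N ] 𝟙 (P? (f t))
  length-filter-map P? f = trans
    (cong (λ xs → + length (filter P? xs)) (List.map-tabulate id f))
    (length-filter-tabulate P? f)

  𝕊 : (Subset n → ℤ) → ℤ
  𝕊 {zero}  g = g []
  𝕊 {suc n} g = 𝕊 (λ V → g (inside ∷ V)) + 𝕊 (λ V → g (outside ∷ V))

  𝕊-cong : {f g : Subset n → ℤ} → (∀ V → f V ≡ g V) → 𝕊 f ≡ 𝕊 g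
  𝕊-cong {zero}  eq = eq []
  𝕊-cong {suc n} eq = cong₂ _+_ (𝕊-cong λ V → eq (inside ∷ V)) (𝕊-cong λ V → eq (outside ∷ V))

  𝕊-zero : {f : Subset n → ℤ} → (∀ V → f V ≡ 0ℤ) → 𝕊 f ≡ 0ℤ
  𝕊-zero {zero}  eq = eq []
  𝕊-zero {suc n} eq = cong₂ _+_ (𝕊-zero λ V → eq (inside ∷ V)) (𝕊-zero λ V → eq (outside ∷ V))

  interchange : ∀ a b c d → (a + b) + (c + d) ≡ (a + c) + (b + d)
  interchange = solve-∀

  𝕊-+ : (f g : Subset n → ℤ) → 𝕊 (λ V → f V + g V) ≡ 𝕊 f + 𝕊 g
  𝕊-+ {zero}  f g = refl
  𝕊-+ {suc n} f g = trans
    (cong₂ _+_ (𝕊-+ (f ∘ (inside ∷_)) (g ∘ (inside ∷_))) (𝕊-+ (f ∘ (outside ∷_)) (g ∘ (outside ∷_))))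
    (interchange (𝕊 (f ∘ (inside ∷_))) _ _ _)

  𝕊-*ˡ : ∀ c (f : Subset n → ℤ) → 𝕊 (λ V → c * f V) ≡ c * 𝕊 f
  𝕊-*ˡ {zero}  c f = refl
  𝕊-*ˡ {suc n} c f = trans
    (cong₂ _+_ (𝕊-*ˡ c (f ∘ (inside ∷_))) (𝕊-*ˡ c (f ∘ (outside ∷_))))
    (sym (*-distribˡ-+ c _ _))

  𝕊-minus : (f g : Subset n → ℤ) → 𝕊 (λ V → f V - g V) ≡ 𝕊 f - 𝕊 g
  𝕊-minus f g = begin
    𝕊 (λ V → f V - g V)                ≡⟨ 𝕊-cong (λ V → cong (_+_ (f V)) (sym (-1*i≡-i (g V)))) ⟩
    𝕊 (λ V → f V + -1ℤ * g V)          ≡⟨ 𝕊-+ f (λ V → -1ℤ * g V) ⟩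
    𝕊 f + 𝕊 (λ V → -1ℤ * g V)          ≡⟨ cong (_+_ (𝕊 f)) (trans (𝕊-*ˡ -1ℤ g) (-1*i≡-i (𝕊 g))) ⟩
    𝕊 f - 𝕊 g                          ∎

  𝕊-swap : ∀ {m} (f : Subset m → Subset n → ℤ) → 𝕊 (λ V → 𝕊 (f V)) ≡ 𝕊 (λ W → 𝕊 (λ V → f V W))
  𝕊-swap {m = zero}  f = refl
  𝕊-swap {m = suc m} f = trans
    (cong₂ _+_ (𝕊-swap (f ∘ (inside ∷_))) (𝕊-swap (f ∘ (outside ∷_))))
    (sym (𝕊-+ (λ W → 𝕊 (λ V → f (inside ∷ V) W)) (λ W → 𝕊 (λ V → f (outside ∷ V) W))))

  Σ<-𝕊-swap : ∀ k (f : ℕ → Subset n → ℤ) → Σ< k (λ a → 𝕊 (f a)) ≡ 𝕊 (λ V → Σ< k (λ a → f a V))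
  Σ<-𝕊-swap {n} zero f = sym (𝕊-zero {n} λ _ → refl)
  Σ<-𝕊-swap (suc k) f = trans (cong (_+_ (𝕊 (f 0))) (Σ<-𝕊-swap k (f ∘ suc))) (sym (𝕊-+ (f 0) (λ V → Σ< k (λ a → f (suc a) V))))

  infix 4 _≟ˢ_
  _≟ˢ_ : DecidableEquality (Subset n)
  _≟ˢ_ = Vec.≡-dec Bool._≟_

  𝕊-single : (V : Subset n) (f : Subset n → ℤ) → 𝕊 (λ W → 𝟙 (W ≟ˢ V) * f W) ≡ f V
  𝕊-single []      f = *-identityˡ (f [])
  𝕊-single (s ∷ V) f = case-side s
    where
    same : ∀ s → 𝕊 (λ W → 𝟙 (s ∷ W ≟ˢ s ∷ V) * f (s ∷ W)) ≡ f (s ∷ V)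
    same s = trans
      (𝕊-cong λ W → cong (_* f (s ∷ W)) (𝟙-cong (s ∷ W ≟ˢ s ∷ V) (W ≟ˢ V) Vec.∷-injectiveʳ (cong (s ∷_))))
      (𝕊-single V (f ∘ (s ∷_)))
    diff : ∀ s t → ¬ s ≡ t → 𝕊 (λ W → 𝟙 (s ∷ W ≟ˢ t ∷ V) * f (s ∷ W)) ≡ 0ℤ
    diff s t s≢t = 𝕊-zero λ W → cong (_* f (s ∷ W)) (𝟙-no (s ∷ W ≟ˢ t ∷ V) (s≢t ∘ Vec.∷-injectiveˡ))
    case-side : ∀ s → 𝕊 (λ W → 𝟙 (W ≟ˢ s ∷ V) * f W) ≡ f (s ∷ V)
    case-side inside  = trans (cong₂ _+_ (same inside) (diff outside inside λ ())) (+-identityʳ _)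
    case-side outside = trans (cong₂ _+_ (diff inside outside λ ()) (same outside)) (+-identityˡ _)

  -- Subsets are paired by whether they contain x, and each pair cancels.
  𝕊-toggle : (x : Fin n) (f : Subset n → ℤ) →
    (∀ V → f (V [ x ]≔ inside) + f (V [ x ]≔ outside) ≡ 0ℤ) → 𝕊 f ≡ 0ℤ
  𝕊-toggle zero    f eq = trans (sym (𝕊-+ (f ∘ (inside ∷_)) (f ∘ (outside ∷_)))) (𝕊-zero λ V → eq (inside ∷ V))
  𝕊-toggle (suc x) f eq = cong₂ _+_
    (𝕊-toggle x (f ∘ (inside ∷_)) (λ V → eq (inside ∷ V)))
    (𝕊-toggle x (f ∘ (outside ∷_)) (λ V → eq (outside ∷ V)))

  -- The sum of Φ over the vectors with entries in 1 … k on V and 0 off V: a map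
  -- V → C_k is stored with its values shifted by one, and 0 marks the complement.
  box : Subset n → ℕ → (Vec ℕ n → ℤ) → ℤ
  box []            k Φ = Φ []
  box (inside  ∷ V) k Φ = Σ< k (λ a → box V k (λ v → Φ (suc a ∷ v)))
  box (outside ∷ V) k Φ = box V k (λ v → Φ (0 ∷ v))

  nonzero : ℕ → Side
  nonzero zero    = outside
  nonzero (suc _) = inside

  supp : Vec ℕ n → Subset n
  supp = map nonzero

  InBox : Subset n → ℕ → Vec ℕ n → Set
  InBox V k v = supp v ≡ V × (∀ i → lookup v i ℕ.≤ k)

  box-cong : (V : Subset n) (k : ℕ) {Φ Ψ : Vec ℕ n → ℤ} →
    (∀ v → InBox V k v → Φ v ≡ Ψ v) → box V k Φ ≡ box V k Ψ
  box-cong []            k eq = eq [] (refl , λ ())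
  box-cong (inside  ∷ V) k eq = Σ<-cong k λ a a<k → box-cong V k λ v (s , b) →
    eq (suc a ∷ v) (cong (inside ∷_) s , λ { zero → a<k ; (suc i) → b i })
  box-cong (outside ∷ V) k eq = box-cong V k λ v (s , b) →
    eq (0 ∷ v) (cong (outside ∷_) s , λ { zero → z≤n ; (suc i) → b i })

  box-*ˡ : (V : Subset n) (k : ℕ) (c : ℤ) (Φ : Vec ℕ n → ℤ) → box V k (λ v → c * Φ v) ≡ c * box V k Φ
  box-*ˡ []            k c Φ = refl
  box-*ˡ (inside  ∷ V) k c Φ = trans (Σ<-cong k λ a _ → box-*ˡ V k c (Φ ∘ (suc a ∷_))) (Σ<-*ˡ k c (λ a → box V k (Φ ∘ (suc a ∷_))))
  box-*ˡ (outside ∷ V) k c Φ = box-*ˡ V k c (Φ ∘ (0 ∷_))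

  box-zero : (V : Subset n) (k : ℕ) {Φ : Vec ℕ n → ℤ} →
    (∀ v → InBox V k v → Φ v ≡ 0ℤ) → box V k Φ ≡ 0ℤ
  -- Zero is written as a product so that `box-*ˡ` can pull out a factor 0.
  box-zero V k {Φ} eq = trans (box-cong V k {Ψ = λ _ → 0ℤ * 0ℤ} eq) (box-*ˡ V k 0ℤ (λ _ → 0ℤ))

  -- Lowering sends the entries 1 to 0 and so shrinks the support from V to some W. Conversely, a
  -- vector with support W ⊆ V and entries at most k comes from exactly one vector with support V:
  -- raise its entries on V by one.
  box-pred : (V : Subset n) (k : ℕ) (Φ : Vec ℕ n → ℤ) →
    box V (suc k) (Φ ∘ map pred) ≡ 𝕊 (λ W → 𝟙 (W ⊆? V) * box W k Φ)
  box-pred []            k Φ = sym (*-identityˡ (Φ []))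
  box-pred (inside  ∷ V) k Φ = begin
    -- The entry 1 leaves the support, and the larger entries stay in it; these are the two halves
    -- of the sum over W.
    box V (suc k) (Φ ∘ (0 ∷_) ∘ map pred) + Σ< k (λ a → box V (suc k) (Φ ∘ (suc a ∷_) ∘ map pred))
      ≡⟨ +-comm (box V (suc k) (Φ ∘ (0 ∷_) ∘ map pred)) _ ⟩
    Σ< k (λ a → box V (suc k) (Φ ∘ (suc a ∷_) ∘ map pred)) + box V (suc k) (Φ ∘ (0 ∷_) ∘ map pred)
      ≡⟨ cong₂ _+_ (Σ<-cong k λ a _ → box-pred V k (Φ ∘ (suc a ∷_))) (box-pred V k (Φ ∘ (0 ∷_))) ⟩
    Σ< k (λ a → 𝕊 (λ W → 𝟙 (W ⊆? V) * box W k (Φ ∘ (suc a ∷_)))) + 𝕊 (λ W → 𝟙 (W ⊆? V) * box W k (Φ ∘ (0 ∷_)))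
      ≡⟨ cong (_+ 𝕊 (λ W → 𝟙 (W ⊆? V) * box W k (Φ ∘ (0 ∷_)))) (Σ<-𝕊-swap k (λ a W → 𝟙 (W ⊆? V) * box W k (Φ ∘ (suc a ∷_)))) ⟩
    𝕊 (λ W → Σ< k (λ a → 𝟙 (W ⊆? V) * box W k (Φ ∘ (suc a ∷_)))) + 𝕊 (λ W → 𝟙 (W ⊆? V) * box W k (Φ ∘ (0 ∷_)))
      ≡⟨ cong₂ _+_
           (𝕊-cong λ W → trans (Σ<-*ˡ k (𝟙 (W ⊆? V)) (λ a → box W k (Φ ∘ (suc a ∷_))))
             (cong (_* box (inside ∷ W) k Φ) (𝟙-cong (W ⊆? V) (inside ∷ W ⊆? inside ∷ V) in⊆in drop-∷-⊆)))
           (𝕊-cong λ W → cong (_* box (outside ∷ W) k Φ)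
             (𝟙-cong (W ⊆? V) (outside ∷ W ⊆? inside ∷ V) (λ s → out⊆ s) drop-∷-⊆)) ⟩
    𝕊 (λ W → 𝟙 (W ⊆? inside ∷ V) * box W k Φ) ∎
  box-pred (outside ∷ V) k Φ = begin
    box V (suc k) (Φ ∘ (0 ∷_) ∘ map pred)
      ≡⟨ box-pred V k (Φ ∘ (0 ∷_)) ⟩
    𝕊 (λ W → 𝟙 (W ⊆? V) * box W k (Φ ∘ (0 ∷_)))
      ≡⟨ +-identityˡ _ ⟨
    0ℤ + 𝕊 (λ W → 𝟙 (W ⊆? V) * box W k (Φ ∘ (0 ∷_)))
      ≡⟨ cong₂ _+_
           (𝕊-zero λ W → cong (_* box (inside ∷ W) k Φ)
             (𝟙-no (inside ∷ W ⊆? outside ∷ V) λ s → case s here of λ ()))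
           (𝕊-cong λ W → cong (_* box (outside ∷ W) k Φ)
             (𝟙-cong (outside ∷ W ⊆? outside ∷ V) (W ⊆? V) drop-∷-⊆ (λ s → out⊆ s))) ⟨
    𝕊 (λ W → 𝟙 (W ⊆? outside ∷ V) * box W k Φ) ∎

  -- The common scheme behind the weak, strict and surjective recursions: all that is lost by
  -- lowering must be a condition on the supports before and after.
  box-peel : (V : Subset n) (k : ℕ) {Φ Ψ : Vec ℕ n → ℤ} (c : Subset n → Subset n → ℤ) →
    (∀ v → Φ v ≡ c (supp v) (supp (map pred v)) * Ψ (map pred v)) →
    box V (suc k) Φ ≡ 𝕊 (λ W → 𝟙 (W ⊆? V) * (c V W * box W k Ψ))
  box-peel V k {Φ} {Ψ} c eq = begin
    box V (suc k) Φ
      ≡⟨ box-cong V (suc k) (λ v (s , _) → trans (eq v) (cong (λ U → c U (supp (map pred v)) * Ψ (map pred v)) s)) ⟩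
    box V (suc k) ((λ u → c V (supp u) * Ψ u) ∘ map pred)
      ≡⟨ box-pred V k _ ⟩
    𝕊 (λ W → 𝟙 (W ⊆? V) * box W k (λ u → c V (supp u) * Ψ u))
      ≡⟨ 𝕊-cong (λ W → cong (_*_ (𝟙 (W ⊆? V))) (trans
           (box-cong W k (λ u (s , _) → cong (λ U → c V U * Ψ u) s)) (box-*ˡ W k (c V W) Ψ))) ⟩
    𝕊 (λ W → 𝟙 (W ⊆? V) * (c V W * box W k Ψ)) ∎

  Σ<-trim : ∀ k q (f : ℕ → ℤ) → (∀ a → k ℕ.≤ a → a ℕ.< k ℕ.+ q → f a ≡ 0ℤ) → Σ< (k ℕ.+ q) f ≡ Σ< k f
  Σ<-trim k q f vanish = begin
    Σ< (k ℕ.+ q) f                       ≡⟨ Σ<-split k q f ⟩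
    Σ< k f + Σ< q (λ a → f (k ℕ.+ a))    ≡⟨ cong (_+_ (Σ< k f)) (Σ<-zero q λ a a<q → vanish (k ℕ.+ a) (ℕ.m≤m+n k a) (ℕ.+-monoʳ-< k a<q)) ⟩
    Σ< k f + 0ℤ                          ≡⟨ +-identityʳ _ ⟩
    Σ< k f                               ∎

  Σ<-shift : ∀ ρ k r (f : ℕ → ℤ) → ρ ℕ.≤ r →
    (∀ a → a ℕ.< k ℕ.+ r → ¬ (ρ ℕ.≤ a × a ℕ.< ρ ℕ.+ k) → f a ≡ 0ℤ) →
    Σ< (k ℕ.+ r) f ≡ Σ< k (λ a → f (a ℕ.+ ρ))
  Σ<-shift ρ k r f ρ≤r vanish = begin
    Σ< (k ℕ.+ r) f                                ≡⟨ cong (λ N → Σ< N f) k+r≡ ⟩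
    Σ< (ρ ℕ.+ (k ℕ.+ q)) f                        ≡⟨ Σ<-split ρ (k ℕ.+ q) f ⟩
    Σ< ρ f + Σ< (k ℕ.+ q) (λ a → f (ρ ℕ.+ a))
      ≡⟨ cong₂ _+_
           (Σ<-zero ρ λ a a<ρ → vanish a (ℕ.<-≤-trans a<ρ (ℕ.≤-trans ρ≤r (ℕ.m≤n+m r k)))
             λ (ρ≤a , _) → ℕ.<⇒≱ a<ρ ρ≤a)
           (Σ<-trim k q _ λ a k≤a a<k+q → vanish (ρ ℕ.+ a)
             (subst (ρ ℕ.+ a ℕ.<_) (sym k+r≡) (ℕ.+-monoʳ-< ρ a<k+q))
             λ (_ , ρ+a<ρ+k) → ℕ.<⇒≱ (ℕ.+-cancelˡ-< ρ a k ρ+a<ρ+k) k≤a) ⟩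
    0ℤ + Σ< k (λ a → f (ρ ℕ.+ a))                 ≡⟨ +-identityˡ _ ⟩
    Σ< k (λ a → f (ρ ℕ.+ a))                      ≡⟨ Σ<-cong k (λ a _ → cong f (ℕ.+-comm ρ a)) ⟩
    Σ< k (λ a → f (a ℕ.+ ρ))                      ∎
    where
    q = r ℕ.∸ ρ
    k+r≡ : k ℕ.+ r ≡ ρ ℕ.+ (k ℕ.+ q)
    k+r≡ = trans (cong (ℕ._+_ k) (sym (ℕ.m+[n∸m]≡n ρ≤r))) (trans (sym (ℕ.+-assoc k ρ q))
      (trans (cong (ℕ._+ q) (ℕ.+-comm k ρ)) (ℕ.+-assoc ρ k q)))

  -- A translation by `ρ` carries 1 ... k in each coordinate to a window just above the offset
  -- there, and the vectors outside these windows contribute nothing. The offsets vary with the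
  -- coordinate so that `ρ` can later be the rank.
  box-shift : (ρ : Vec ℕ n) (k r : ℕ) (Φ : Vec ℕ n → ℤ) → (∀ i → lookup ρ i ℕ.≤ r) →
    (∀ v → InBox ⊤ (k ℕ.+ r) v → ∀ i →
      ¬ (lookup ρ i ℕ.< lookup v i × lookup v i ℕ.≤ lookup ρ i ℕ.+ k) → Φ v ≡ 0ℤ) →
    box ⊤ (k ℕ.+ r) Φ ≡ box ⊤ k (λ u → Φ (zipWith ℕ._+_ u ρ))
  box-shift []      k r Φ ρ≤r vanish = refl
  box-shift (x ∷ ρ) k r Φ ρ≤r vanish = trans
    (Σ<-shift x k r _ (ρ≤r zero) λ a a<k+r out →
      box-zero ⊤ (k ℕ.+ r) λ v v∈ → vanish (suc a ∷ v) (extend a<k+r v∈) zero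
        λ (x<1+a , 1+a≤x+k) → out (ℕ.≤-pred x<1+a , 1+a≤x+k))
    (Σ<-cong k λ a a<k → box-shift ρ k r (Φ ∘ (suc (a ℕ.+ x) ∷_)) (ρ≤r ∘ suc)
      λ v v∈ i → vanish (suc (a ℕ.+ x) ∷ v) (extend (ℕ.+-mono-<-≤ a<k (ρ≤r zero)) v∈) (suc i))
    where
    extend : ∀ {a v} → a ℕ.< k ℕ.+ r → InBox ⊤ (k ℕ.+ r) v → InBox ⊤ (k ℕ.+ r) (suc a ∷ v)
    extend a< (s , b) = cong (inside ∷_) s , λ { zero → a< ; (suc i) → b i }

  -- Enumerating the maps into a chain

  sum-↑ : ∀ m n (g : Fin (m ℕ.+ n) → ℤ) →
    ∑[ i < m ℕ.+ n ] g i ≡ ∑[ i < m ] g (i ↑ˡ n) + ∑[ j < n ] g (m ↑ʳ j)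
  sum-↑ zero    n g = sym (+-identityˡ _)
  sum-↑ (suc m) n g = trans (cong (_+_ (g zero)) (sum-↑ m n (g ∘ suc))) (sym (+-assoc (g zero) _ _))

  sum-combine : ∀ m n (g : Fin (m ℕ.* n) → ℤ) →
    ∑[ i < m ℕ.* n ] g i ≡ ∑[ i < m ] ∑[ j < n ] g (combine i j)
  sum-combine zero    n g = refl
  sum-combine (suc m) n g = trans (sum-↑ n (m ℕ.* n) g)
    (cong (_+_ (∑[ j < n ] g (j ↑ˡ (m ℕ.* n)))) (sum-combine m n (g ∘ (n ↑ʳ_))))

  -- A code t < k^(n + 1) splits into the first value and a code for the remaining n values, which
  -- turns the flat enumeration into nested sums.
  box-finToFun : ∀ n k (Φ : Vec ℕ n → ℤ) →
    ∑[ t < k ℕ.^ n ] Φ (tabulate (suc ∘ toℕ ∘ finToFun t)) ≡ box ⊤ k Φ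
  box-finToFun zero    k Φ = +-identityʳ (Φ [])
  box-finToFun (suc n) k Φ = begin
    ∑[ t < k ℕ.^ suc n ] Φ (tabulate (suc ∘ toℕ ∘ finToFun t))
      ≡⟨ sum-combine k (k ℕ.^ n) _ ⟩
    ∑[ a < k ] ∑[ t < k ℕ.^ n ] Φ (tabulate (suc ∘ toℕ ∘ finToFun {k} {suc n} (combine a t)))
      ≡⟨ Sum.sum-cong-≗ {k} (λ a → Sum.sum-cong-≗ {k ℕ.^ n} (λ t →
           cong (λ (b , u) → Φ (suc (toℕ b) ∷ tabulate (suc ∘ toℕ ∘ finToFun u))) (Fin.remQuot-combine a t))) ⟩
    ∑[ a < k ] ∑[ t < k ℕ.^ n ] Φ (suc (toℕ a) ∷ tabulate (suc ∘ toℕ ∘ finToFun t))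
      ≡⟨ Sum.sum-cong-≗ {k} (λ a → box-finToFun n k (Φ ∘ (suc (toℕ a) ∷_))) ⟩
    box ⊤ k Φ ∎

  -- Order polynomials of up-sets

  ∇^-𝕊 : ∀ k h (c : Subset n → ℤ) (G : Subset n → ℤ → ℤ) z →
    ∇^ k h (λ y → 𝕊 (λ W → c W * G W y)) z ≡ 𝕊 (λ W → c W * ∇^ k h (G W) z)
  ∇^-𝕊 zero    h c G z = refl
  ∇^-𝕊 (suc k) h c G z = begin
    ∇^ k h (λ y → 𝕊 (λ W → c W * G W y)) z - ∇^ k h (λ y → 𝕊 (λ W → c W * G W y)) (z - h)
      ≡⟨ cong₂ _-_ (∇^-𝕊 k h c G z) (∇^-𝕊 k h c G (z - h)) ⟩
    𝕊 (λ W → c W * ∇^ k h (G W) z) - 𝕊 (λ W → c W * ∇^ k h (G W) (z - h))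
      ≡⟨ 𝕊-minus (λ W → c W * ∇^ k h (G W) z) (λ W → c W * ∇^ k h (G W) (z - h)) ⟨
    𝕊 (λ W → c W * ∇^ k h (G W) z - c W * ∇^ k h (G W) (z - h))
      ≡⟨ 𝕊-cong (λ W → factor (c W) _ _) ⟩
    𝕊 (λ W → c W * ∇^ (suc k) h (G W) z) ∎
    where
    factor : ∀ c a b → c * a - c * b ≡ c * (a - b)
    factor = solve-∀

  ∇^-translate : ∀ k h G z → ∇^ k h (λ y → G (y - h)) z ≡ ∇^ k h G (z - h)
  ∇^-translate zero    h G z = refl
  ∇^-translate (suc k) h G z = cong₂ _-_ (∇^-translate k h G z) (∇^-translate k h G (z - h))

  ∇-constant : ∀ A → (∀ z → ∇ 1ℤ A z ≡ 0ℤ) → ∀ z → A z ≡ A 0ℤ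
  ∇-constant A eq (+ zero)      = refl
  ∇-constant A eq (+ suc k)     = trans (i-j≡0⇒i≡j (A (+ suc k)) (A (+ k)) (eq (+ suc k))) (∇-constant A eq (+ k))
  ∇-constant A eq -[1+ zero ]   = sym (i-j≡0⇒i≡j (A 0ℤ) (A -[1+ 0 ]) (eq 0ℤ))
  ∇-constant A eq -[1+ suc k ]  = trans
    (sym (i-j≡0⇒i≡j (A -[1+ k ]) (A -[1+ suc k ])
      -- Subtracting 1 from `-[1+ k ]` computes to `-[1+ suc (k + 0) ]`, whence the rewriting by
      -- `+-identityʳ`.
      (trans (cong (λ j → A -[1+ k ] - A -[1+ suc j ]) (sym (ℕ.+-identityʳ k))) (eq -[1+ k ]))))
    (∇-constant A eq -[1+ k ])

  ⊆∧≢⇒⊂ : {W V : Subset n} → W ⊆ V → W ≢ V → W ⊂ V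
  ⊆∧≢⇒⊂ {n} {W} {V} W⊆V W≢V with Fin.any? (λ x → x ∈? V ×-dec ¬? (x ∈? W))
  ... | yes x   = W⊆V , x
  ... | no none = contradiction (⊆-antisym W⊆V V⊆W) W≢V
    where
    V⊆W : V ⊆ W
    V⊆W {x} x∈V with x ∈? W
    ... | yes x∈W = x∈W
    ... | no x∉W  = contradiction (x , x∈V , x∉W) none

  ∈-supp⁺ : (v : Vec ℕ n) {i : Fin n} → 0 ℕ.< lookup v i → i ∈ supp v
  ∈-supp⁺ (suc x ∷ v) {zero}  0<x = here
  ∈-supp⁺ (x ∷ v)     {suc i} 0<v = there (∈-supp⁺ v 0<v)

  ∈-supp⁻ : (v : Vec ℕ n) {i : Fin n} → i ∈ supp v → 0 ℕ.< lookup v i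
  ∈-supp⁻ (suc x ∷ v) {zero}  _   = s≤s z≤n
  ∈-supp⁻ (x ∷ v)     {suc i} i∈ = ∈-supp⁻ v (drop-there i∈)

  []≔-∈ : (V : Subset n) {x i : Fin n} {s t : Side} → i ≢ x → i ∈ V [ x ]≔ s → i ∈ V [ x ]≔ t
  []≔-∈ (_ ∷ V) {zero}  {zero}  i≢x _          = contradiction refl i≢x
  []≔-∈ (_ ∷ V) {zero}  {suc i} i≢x (there i∈) = there i∈
  []≔-∈ (_ ∷ V) {suc x} {zero}  i≢x here       = here
  []≔-∈ (_ ∷ V) {suc x} {suc i} i≢x (there i∈) = there ([]≔-∈ V (i≢x ∘ cong suc) i∈)

  ∣[]≔∣ : (V : Subset n) (x : Fin n) → ∣ V [ x ]≔ inside ∣ ≡ suc ∣ V [ x ]≔ outside ∣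
  ∣[]≔∣ (_       ∷ V) zero    = refl
  ∣[]≔∣ (inside  ∷ V) (suc x) = cong suc (∣[]≔∣ V x)
  ∣[]≔∣ (outside ∷ V) (suc x) = ∣[]≔∣ V x

  σ : Subset n → ℤ
  σ V = -1ℤ ^ ∣ V ∣

  -- With no values available the box is empty unless V is, and the empty set has sign 1.
  σ-box-0 : (V : Subset n) (Φ : Vec ℕ n → ℤ) → σ V * box V 0 Φ ≡ box V 0 Φ
  σ-box-0 []            Φ = *-identityˡ (Φ [])
  σ-box-0 (inside  ∷ V) Φ = *-zeroʳ (σ (inside ∷ V))
  σ-box-0 (outside ∷ V) Φ = σ-box-0 V (Φ ∘ (0 ∷_))

  -- Well-founded descent. One search provides the maximal elements (in the flipped order), the
  -- covers in saturated chains, and the minimal elements of the poset.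
  minimal-below : ∀ {ℓ p} {_⊑_ : Rel (Fin n) ℓ} {P : Pred (Fin n) p} →
    IsPartialOrder _≡_ _⊑_ → Decidable₂ _⊑_ → Decidable P → ∀ {i} → P i →
    ∃[ m ] m ⊑ i × P m × (∀ j → j ⊑ m → j ≢ m → ¬ P j)
  minimal-below {n} {_⊑_ = _⊑_} {P} isPO _⊑?_ P? {i} = go (po-wellFounded isPO i)
    where
    module ⊑ = IsPartialOrder isPO
    go : ∀ {i} → Acc _ i → P i → ∃[ m ] m ⊑ i × P m × (∀ j → j ⊑ m → j ≢ m → ¬ P j)
    go {i} (acc below) Pi with Fin.any? (λ j → (j ⊑? i ×-dec ¬? (j Fin.≟ i)) ×-dec P? j)
    ... | no none                = i , ⊑.refl , Pi , λ j j⊑i j≢i Pj → none (j , (j⊑i , j≢i) , Pj)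
    ... | yes (j , j⊏i , Pj) with go (below j⊏i) Pj
    ... | m , m⊑j , rest = m , ⊑.trans m⊑j (proj₁ j⊏i) , rest

  -- Weak, strict and surjective maps as vectors

  module Order {ℓ} {d : ℕ} {_≼_ : Rel (Fin d) ℓ} (isPO : IsPartialOrder _≡_ _≼_) (_≼?_ : Decidable₂ _≼_) where

    module ≼ = IsPartialOrder isPO

    infix 4 _≺_ _≺?_
    _≺_ : Rel (Fin d) ℓ
    i ≺ j = i ≼ j × i ≢ j

    _≺?_ : Decidable₂ _≺_
    i ≺? j = i ≼? j ×-dec ¬? (i Fin.≟ j)

    maximal-above : ∀ {p} {P : Pred (Fin d) p} → Decidable P → ∀ {i} → P i →
      ∃[ m ] i ≼ m × P m × (∀ j → m ≺ j → ¬ P j)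
    maximal-above P? Pi with minimal-below (Flip.isPartialOrder isPO) (flip _≼?_) P? Pi
    ... | m , i≼m , Pm , max = m , i≼m , Pm , λ j (m≼j , m≢j) → max j m≼j (m≢j ∘ sym)

    Up : Pred (Subset d) ℓ
    Up V = ∀ i j → i ≼ j → i ∈ V → j ∈ V

    up? : Decidable Up
    up? V = Fin.all? λ i → Fin.all? λ j → i ≼? j →-dec (i ∈? V →-dec j ∈? V)

    -- What strictness demands of a support V and the set W of elements with value at least 2. For W
    -- ⊆ V it makes V an up-set and leaves an antichain in V outside W.
    Above : Subset d → Pred (Subset d) ℓ
    Above V W = ∀ i j → i ≺ j → i ∈ V → j ∈ W

    above? : ∀ V → Decidable (Above V)
    above? V W = Fin.all? λ i → Fin.all? λ j → i ≺? j →-dec (i ∈? V →-dec j ∈? W)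

    Weak : Pred (Vec ℕ d) ℓ
    Weak v = ∀ i j → i ≼ j → lookup v i ℕ.≤ lookup v j

    weak? : Decidable Weak
    weak? v = Fin.all? λ i → Fin.all? λ j → i ≼? j →-dec lookup v i ℕ.≤? lookup v j

    -- The complement of the support is exempt from strictness.
    Strict : Pred (Vec ℕ d) ℓ
    Strict v = ∀ i j → i ≺ j → 0 ℕ.< lookup v i → lookup v i ℕ.< lookup v j

    strict? : Decidable Strict
    strict? v = Fin.all? λ i → Fin.all? λ j → i ≺? j →-dec (0 ℕ.<? lookup v i →-dec lookup v i ℕ.<? lookup v j)

    Onto : ℕ → Vec ℕ d → Set
    Onto k v = ∀ (a : Fin k) → ∃[ i ] lookup v i ≡ suc (toℕ a)

    onto? : ∀ k → Decidable (Onto k)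
    onto? k v = Fin.all? λ a → Fin.any? λ i → lookup v i ℕ.≟ suc (toℕ a)

    -- With entries at most k these encode the chains of up-sets with k proper inclusions from the
    -- support down to the empty set: each of the values 1 ... k is taken, so every lowering loses
    -- an element.
    Surj : ℕ → Pred (Vec ℕ d) ℓ
    Surj k v = Weak v × Onto k v

    surj? : ∀ k → Decidable (Surj k)
    surj? k v = weak? v ×-dec onto? k v

    -- Lowering all values by one

    lookup-pred : ∀ (v : Vec ℕ d) i → lookup (map pred v) i ≡ pred (lookup v i)
    lookup-pred v i = Vec.lookup-map i pred v

    Weak⇒Up : ∀ v → Weak v → Up (supp v)
    Weak⇒Up v w i j i≼j i∈ = ∈-supp⁺ v (ℕ.<-≤-trans (∈-supp⁻ v i∈) (w i j i≼j))

    Strict⇒Up : ∀ v → Strict v → Up (supp v)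
    Strict⇒Up v s i j i≼j i∈ with i Fin.≟ j
    ... | yes refl = i∈
    ... | no  i≢j  = ∈-supp⁺ v (ℕ.≤-<-trans z≤n (s i j (i≼j , i≢j) (∈-supp⁻ v i∈)))

    Weak-pred : ∀ v → Weak v → Weak (map pred v)
    Weak-pred v w i j i≼j rewrite lookup-pred v i | lookup-pred v j = ℕ.pred-mono-≤ (w i j i≼j)

    -- Lowering confuses only 0 with 1, and there the up-set condition restores the inequality.
    Weak-unpred : ∀ v → Up (supp v) → Weak (map pred v) → Weak v
    Weak-unpred v up w i j i≼j with w i j i≼j
    ... | w′ rewrite lookup-pred v i | lookup-pred v j with lookup v i in vᵢ
    ... | zero  = z≤n
    ... | suc x with lookup v j | ∈-supp⁻ v (up i j i≼j (∈-supp⁺ v (subst (0 ℕ.<_) (sym vᵢ) (s≤s z≤n))))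
    ... | suc y | _ = s≤s w′

    weak-peel : ∀ v → 𝟙 (weak? v) ≡ 𝟙 (up? (supp v)) * 𝟙 (weak? (map pred v))
    weak-peel v = trans
      (𝟙-cong (weak? v) (up? (supp v) ×-dec weak? (map pred v))
        (λ w → Weak⇒Up v w , Weak-pred v w) (λ (up , w) → Weak-unpred v up w))
      (𝟙-× (up? (supp v)) (weak? (map pred v)))

    Strict⇒Above : ∀ v → Strict v → Above (supp v) (supp (map pred v))
    Strict⇒Above v s i j i≺j i∈ = ∈-supp⁺ (map pred v)
      (subst (0 ℕ.<_) (sym (lookup-pred v j))
        (ℕ.pred-mono-≤ (ℕ.≤-trans (s≤s (∈-supp⁻ v i∈)) (s i j i≺j (∈-supp⁻ v i∈)))))

    Strict-pred : ∀ v → Strict v → Strict (map pred v)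
    Strict-pred v s i j i≺j 0<vᵢ with s i j i≺j
    ... | s′ rewrite lookup-pred v i | lookup-pred v j with lookup v i | lookup v j
    ... | suc x | y = ℕ.pred-mono-≤ (s′ (s≤s z≤n))

    -- Only a value 1 at i escapes the strictness of the lowered vector, and for it `Above` makes
    -- the value at j at least 2.
    Strict-unpred : ∀ v → Above (supp v) (supp (map pred v)) → Strict (map pred v) → Strict v
    Strict-unpred v above s i j i≺j 0<vᵢ
      with s i j i≺j | ∈-supp⁻ (map pred v) (above i j i≺j (∈-supp⁺ v 0<vᵢ))
    ... | s′ | 0<pvⱼ rewrite lookup-pred v i | lookup-pred v j with lookup v i | lookup v j
    ... | suc zero    | suc y = s≤s 0<pvⱼ
    ... | suc (suc x) | suc y = s≤s (s′ (s≤s z≤n))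

    strict-peel : ∀ v → 𝟙 (strict? v) ≡ 𝟙 (above? (supp v) (supp (map pred v))) * 𝟙 (strict? (map pred v))
    strict-peel v = trans
      (𝟙-cong (strict? v) (above? (supp v) (supp (map pred v)) ×-dec strict? (map pred v))
        (λ s → Strict⇒Above v s , Strict-pred v s) (λ (above , s) → Strict-unpred v above s))
      (𝟙-× (above? (supp v) (supp (map pred v))) (strict? (map pred v)))

    Onto⇒≢ : ∀ {k} v → Onto (suc k) v → supp (map pred v) ≢ supp v
    Onto⇒≢ v onto eq with onto zero
    ... | i , vᵢ≡1 with ∈-supp⁻ (map pred v) (subst (i ∈_) (sym eq) (∈-supp⁺ v (subst (0 ℕ.<_) (sym vᵢ≡1) (s≤s z≤n))))
    ... | 0<pvᵢ rewrite lookup-pred v i | vᵢ≡1 = contradiction 0<pvᵢ λ ()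

    Onto-pred : ∀ {k} v → Onto (suc k) v → Onto k (map pred v)
    Onto-pred v onto a with onto (suc a)
    ... | i , vᵢ≡ = i , trans (lookup-pred v i) (cong pred vᵢ≡)

    -- If the value 1 were not taken, lowering would keep the support; the other values come from
    -- the lowered vector.
    Onto-unpred : ∀ {k} v → supp (map pred v) ≢ supp v → Onto k (map pred v) → Onto (suc k) v
    Onto-unpred v ≢ onto zero with Fin.any? (λ i → lookup v i ℕ.≟ 1)
    ... | yes one = one
    ... | no none = contradiction (⊆-antisym (λ {i} → shrink i) (λ {i} → grow i)) ≢
      where
      shrink : ∀ i → i ∈ supp (map pred v) → i ∈ supp v
      shrink i i∈ = ∈-supp⁺ v (ℕ.≤-trans (subst (0 ℕ.<_) (lookup-pred v i) (∈-supp⁻ (map pred v) i∈)) ℕ.pred[n]≤n)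
      grow : ∀ i → i ∈ supp v → i ∈ supp (map pred v)
      grow i i∈ = ∈-supp⁺ (map pred v) (subst (0 ℕ.<_) (sym (lookup-pred v i))
        (ℕ.pred-mono-≤ (ℕ.≤∧≢⇒< (∈-supp⁻ v i∈) λ 1≡vᵢ → none (i , sym 1≡vᵢ))))
    Onto-unpred v ≢ onto (suc a) with onto a
    ... | i , pvᵢ≡ with lookup v i in vᵢ | trans (sym (lookup-pred v i)) pvᵢ≡
    ... | suc x | x≡ = i , trans vᵢ (cong suc x≡)

    surj-peel : ∀ k v → 𝟙 (surj? (suc k) v) ≡
      𝟙 (up? (supp v)) * 𝟙 (¬? (supp (map pred v) ≟ˢ supp v)) * 𝟙 (surj? k (map pred v))
    surj-peel k v = begin
      𝟙 (surj? (suc k) v)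
        ≡⟨ 𝟙-cong (surj? (suc k) v) ((up? (supp v) ×-dec ≢?) ×-dec surj? k (map pred v))
             (λ (w , o) → (Weak⇒Up v w , Onto⇒≢ v o) , Weak-pred v w , Onto-pred v o)
             (λ ((up , ≢) , w , o) → Weak-unpred v up w , Onto-unpred v ≢ o) ⟩
      𝟙 ((up? (supp v) ×-dec ≢?) ×-dec surj? k (map pred v))
        ≡⟨ 𝟙-× (up? (supp v) ×-dec ≢?) (surj? k (map pred v)) ⟩
      𝟙 (up? (supp v) ×-dec ≢?) * 𝟙 (surj? k (map pred v))
        ≡⟨ cong (_* 𝟙 (surj? k (map pred v))) (𝟙-× (up? (supp v)) ≢?) ⟩
      𝟙 (up? (supp v)) * 𝟙 ≢? * 𝟙 (surj? k (map pred v)) ∎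
      where ≢? = ¬? (supp (map pred v) ≟ˢ supp v)

    -- Recursions for the three counts

    weakCount strictCount surjCount : ℕ → Subset d → ℤ
    weakCount   k V = box V k (λ v → 𝟙 (weak? v))
    strictCount k V = box V k (λ v → 𝟙 (strict? v))
    surjCount   k V = box V k (λ v → 𝟙 (surj? k v))

    weakCount-suc : ∀ k V → weakCount (suc k) V ≡ 𝕊 (λ W → 𝟙 (W ⊆? V) * (𝟙 (up? V) * weakCount k W))
    weakCount-suc k V = box-peel V k (λ V W → 𝟙 (up? V)) weak-peel

    strictCount-suc : ∀ k V → strictCount (suc k) V ≡ 𝕊 (λ W → 𝟙 (W ⊆? V) * (𝟙 (above? V W) * strictCount k W))
    strictCount-suc k V = box-peel V k (λ V W → 𝟙 (above? V W)) strict-peel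

    surjCount-suc : ∀ k V → surjCount (suc k) V ≡
      𝕊 (λ W → 𝟙 (W ⊆? V) * (𝟙 (up? V) * 𝟙 (¬? (W ≟ˢ V)) * surjCount k W))
    surjCount-suc k V = box-peel V k (λ V W → 𝟙 (up? V) * 𝟙 (¬? (W ≟ˢ V))) (surj-peel k)

    weakCount-0 : ∀ V → weakCount 0 V ≡ surjCount 0 V
    weakCount-0 V = box-cong V 0 λ v _ → 𝟙-cong (weak? v) (surj? 0 v) (λ w → w , λ ()) proj₁

    strictCount-0 : ∀ V → strictCount 0 V ≡ weakCount 0 V
    strictCount-0 V = box-cong V 0 λ v (_ , v≤0) → 𝟙-cong (strict? v) (weak? v)
      (λ _ i j _ → ℕ.≤-trans (v≤0 i) z≤n)
      (λ _ i j _ 0<vᵢ → contradiction (v≤0 i) (ℕ.<⇒≱ 0<vᵢ))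

    weakCount-¬Up : ∀ k {V} → ¬ Up V → weakCount k V ≡ 0ℤ
    weakCount-¬Up k {V} ¬up = box-zero V k λ v (s , _) → 𝟙-no (weak? v) λ w → ¬up (subst Up s (Weak⇒Up v w))

    strictCount-¬Up : ∀ k {V} → ¬ Up V → strictCount k V ≡ 0ℤ
    strictCount-¬Up k {V} ¬up = box-zero V k λ v (s , _) → 𝟙-no (strict? v) λ w → ¬up (subst Up s (Strict⇒Up v w))

    -- Reciprocity for strict maps

    Between : Subset d → Subset d → Pred (Subset d) ℓ
    Between V U W = (W ⊆ V × U ⊆ W) × Above W U

    between? : ∀ V U → Decidable (Between V U)
    between? V U W = (W ⊆? V ×-dec U ⊆? W) ×-dec above? W U

    -- Toggling a maximal element of V ∖ U is a sign-reversing involution.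
    between-σ : ∀ {V} → Up V → ∀ U → 𝕊 (λ W → 𝟙 (between? V U W) * σ W) ≡ 𝟙 (U ≟ˢ V) * σ V
    between-σ {V} up U with U ≟ˢ V
    -- When U = V, the only set between them is V itself.
    ... | yes refl = begin
      𝕊 (λ W → 𝟙 (between? V V W) * σ W)
        ≡⟨ 𝕊-cong (λ W → cong (_* σ W) (𝟙-cong (between? V V W) (W ≟ˢ V)
             (λ ((W⊆V , V⊆W) , _) → ⊆-antisym W⊆V V⊆W)
             (λ { refl → (⊆-refl , ⊆-refl) , λ i j i≺j → up i j (proj₁ i≺j) }))) ⟩
      𝕊 (λ W → 𝟙 (W ≟ˢ V) * σ W)  ≡⟨ 𝕊-single V σ ⟩
      σ V                           ≡⟨ *-identityˡ (σ V) ⟨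
      1ℤ * σ V                      ∎
    ... | no U≢V with U ⊆? V
    ... | no U⊈V = 𝕊-zero λ W → cong (_* σ W) (𝟙-no (between? V U W) λ ((W⊆V , U⊆W) , _) → U⊈V (⊆-trans U⊆W W⊆V))
    ... | yes U⊆V with ⊆∧≢⇒⊂ U⊆V U≢V
    ... | _ , y , y∈V∖U with maximal-above (λ x → x ∈? V ×-dec ¬? (x ∈? U)) y∈V∖U
    ... | x , _ , (x∈V , x∉U) , max = 𝕊-toggle x _ cancel
      where
      -- Maximality of x puts everything strictly above it into U, so inserting x into W cannot
      -- violate `Above W U`.
      above-x : ∀ j → x ≺ j → j ∈ U
      above-x j x≺j with j ∈? U
      ... | yes j∈U = j∈U
      ... | no  j∉U = contradiction (up x j (proj₁ x≺j) x∈V , j∉U) (max j x≺j)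
      change : ∀ s {t} W → Between V U (W [ x ]≔ s) → Between V U (W [ x ]≔ t)
      change s {t} W ((⊆V , U⊆) , above) = (⊆V′ , U⊆′) , above′
        where
        ⊆V′ : W [ x ]≔ t ⊆ V
        ⊆V′ {i} i∈ with i Fin.≟ x
        ... | yes refl = x∈V
        ... | no  i≢x  = ⊆V ([]≔-∈ W i≢x i∈)
        U⊆′ : U ⊆ W [ x ]≔ t
        U⊆′ {i} i∈U = []≔-∈ W (λ { refl → x∉U i∈U }) (U⊆ i∈U)
        above′ : Above (W [ x ]≔ t) U
        above′ i j i≺j i∈ with i Fin.≟ x
        ... | yes refl = above-x j i≺j
        ... | no  i≢x  = above i j i≺j ([]≔-∈ W i≢x i∈)
      cancel : ∀ W → 𝟙 (between? V U (W [ x ]≔ inside)) * σ (W [ x ]≔ inside) +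
                     𝟙 (between? V U (W [ x ]≔ outside)) * σ (W [ x ]≔ outside) ≡ 0ℤ
      cancel W rewrite ∣[]≔∣ W x
        | 𝟙-cong (between? V U (W [ x ]≔ inside)) (between? V U (W [ x ]≔ outside))
            (change inside W) (change outside W) =
        opposite (𝟙 (between? V U (W [ x ]≔ outside))) (σ (W [ x ]≔ outside))
        where
        opposite : ∀ a s → a * (-1ℤ * s) + a * s ≡ 0ℤ
        opposite = solve-∀

    -- Expand the right side by the strict recursion and exchange the sums: each U is weighted by
    -- the alternating sum of `between-σ`, so only U = V survives. This is the weak recursion at
    -- negative arguments.
    strictCount-reciprocal : ∀ k {V} → Up V →
      σ V * strictCount k V ≡ 𝕊 (λ W → 𝟙 (W ⊆? V) * (σ W * strictCount (suc k) W))
    strictCount-reciprocal k {V} up = sym (begin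
      𝕊 (λ W → 𝟙 (W ⊆? V) * (σ W * strictCount (suc k) W))
        ≡⟨ 𝕊-cong (λ W → trans (cong (λ y → 𝟙 (W ⊆? V) * (σ W * y)) (strictCount-suc k W)) (expand W)) ⟩
      𝕊 (λ W → 𝕊 (λ U → T U * (𝟙 (between? V U W) * σ W)))
        ≡⟨ 𝕊-swap (λ W U → T U * (𝟙 (between? V U W) * σ W)) ⟩
      𝕊 (λ U → 𝕊 (λ W → T U * (𝟙 (between? V U W) * σ W)))
        ≡⟨ 𝕊-cong (λ U → trans (𝕊-*ˡ (T U) (λ W → 𝟙 (between? V U W) * σ W)) (cong (_*_ (T U)) (between-σ up U))) ⟩
      𝕊 (λ U → T U * (𝟙 (U ≟ˢ V) * σ V))
        ≡⟨ 𝕊-cong (λ U → rotate (T U) (𝟙 (U ≟ˢ V)) (σ V)) ⟩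
      𝕊 (λ U → 𝟙 (U ≟ˢ V) * (σ V * T U))
        ≡⟨ 𝕊-single V (λ U → σ V * T U) ⟩
      σ V * T V ∎)
      where
      T = strictCount k
      rotate : ∀ t b s → t * (b * s) ≡ b * (s * t)
      rotate = solve-∀
      regroup : ∀ p s q a t → p * s * (q * (a * t)) ≡ t * (p * q * a * s)
      regroup = solve-∀
      expand : ∀ W → 𝟙 (W ⊆? V) * (σ W * 𝕊 (λ U → 𝟙 (U ⊆? W) * (𝟙 (above? W U) * T U))) ≡
                     𝕊 (λ U → T U * (𝟙 (between? V U W) * σ W))
      expand W = begin
        𝟙 (W ⊆? V) * (σ W * 𝕊 (λ U → 𝟙 (U ⊆? W) * (𝟙 (above? W U) * T U)))
          ≡⟨ *-assoc (𝟙 (W ⊆? V)) (σ W) _ ⟨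
        𝟙 (W ⊆? V) * σ W * 𝕊 (λ U → 𝟙 (U ⊆? W) * (𝟙 (above? W U) * T U))
          ≡⟨ 𝕊-*ˡ (𝟙 (W ⊆? V) * σ W) (λ U → 𝟙 (U ⊆? W) * (𝟙 (above? W U) * T U)) ⟨
        𝕊 (λ U → 𝟙 (W ⊆? V) * σ W * (𝟙 (U ⊆? W) * (𝟙 (above? W U) * T U)))
          ≡⟨ 𝕊-cong (λ U → trans
               (regroup (𝟙 (W ⊆? V)) (σ W) (𝟙 (U ⊆? W)) (𝟙 (above? W U)) (T U))
               (cong (λ b → T U * (b * σ W)) (sym (trans
                 (𝟙-× (W ⊆? V ×-dec U ⊆? W) (above? W U))
                 (cong (_* 𝟙 (above? W U)) (𝟙-× (W ⊆? V) (U ⊆? W))))))) ⟩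
        𝕊 (λ U → T U * (𝟙 (between? V U W) * σ W)) ∎

    -- The order polynomial of an up-set V, with its values at negative
    -- integers given by order reciprocity.
    Ω : Subset d → ℤ → ℤ
    Ω V (+ k)    = weakCount k V
    Ω V -[1+ k ] = σ V * strictCount (suc k) V

    Ω-¬Up : ∀ {V} → ¬ Up V → ∀ z → Ω V z ≡ 0ℤ
    Ω-¬Up ¬up (+ k)        = weakCount-¬Up k ¬up
    Ω-¬Up {V} ¬up -[1+ k ] = trans (cong (_*_ (σ V)) (strictCount-¬Up (suc k) ¬up)) (*-zeroʳ (σ V))

    Ω-Up : ∀ {V} → Up V → ∀ z → Ω V z ≡ 𝕊 (λ W → 𝟙 (W ⊆? V) * Ω W (z - 1ℤ))
    Ω-Up {V} up (+ suc k) = trans (weakCount-suc k V) (𝕊-cong λ W →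
      cong (_*_ (𝟙 (W ⊆? V))) (trans (cong (_* weakCount k W) (𝟙-yes (up? V) up)) (*-identityˡ _)))
    -- At 0 the weak count may be read as a signed strict count, since only the empty set
    -- contributes; reciprocity then carries the recursion across 0.
    Ω-Up {V} up (+ zero) = begin
      weakCount 0 V            ≡⟨ strictCount-0 V ⟨
      strictCount 0 V          ≡⟨ σ-box-0 V _ ⟨
      σ V * strictCount 0 V    ≡⟨ strictCount-reciprocal 0 up ⟩
      𝕊 (λ W → 𝟙 (W ⊆? V) * Ω W -1ℤ) ∎
    Ω-Up {V} up -[1+ k ] = trans (strictCount-reciprocal (suc k) up) (𝕊-cong λ W →
      cong (λ j → 𝟙 (W ⊆? V) * Ω W -[1+ suc j ]) (sym (ℕ.+-identityʳ k)))

    -- The weight of one step in a chain of up-sets. Its factors are those of `surjCount-suc`, so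
    -- that the two recursions agree term by term.
    coeff : Subset d → Subset d → ℤ
    coeff V W = 𝟙 (W ⊆? V) * (𝟙 (up? V) * 𝟙 (¬? (W ≟ˢ V)))

    coeff-¬Up : ∀ {V} W → ¬ Up V → coeff V W ≡ 0ℤ
    coeff-¬Up {V} W ¬up = trans
      (cong (λ u → 𝟙 (W ⊆? V) * (u * 𝟙 (¬? (W ≟ˢ V)))) (𝟙-no (up? V) ¬up))
      (*-zeroʳ (𝟙 (W ⊆? V)))

    coeff-Up : ∀ {V} W → Up V → coeff V W ≡ 𝟙 (W ⊆? V) - 𝟙 (W ≟ˢ V)
    coeff-Up {V} W up = trans
      (cong (λ u → 𝟙 (W ⊆? V) * (u * 𝟙 (¬? (W ≟ˢ V)))) (𝟙-yes (up? V) up)) difference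
      where
      difference : 𝟙 (W ⊆? V) * (1ℤ * 𝟙 (¬? (W ≟ˢ V))) ≡ 𝟙 (W ⊆? V) - 𝟙 (W ≟ˢ V)
      difference with W ≟ˢ V | W ⊆? V
      ... | no _     | yes _   = refl
      ... | no _     | no _    = refl
      ... | yes _    | yes _   = refl
      ... | yes refl | no W⊈W  = contradiction (λ {x} → ⊆-refl {x = W} {x}) W⊈W

    coeff-¬⊂ : ∀ {V W} → ¬ W ⊂ V → coeff V W ≡ 0ℤ
    coeff-¬⊂ {V} {W} W⊄V with W ⊆? V
    ... | no _    = refl
    ... | yes W⊆V with W ≟ˢ V
    ... | yes _   = cong (_*_ 1ℤ) (*-zeroʳ (𝟙 (up? V)))
    ... | no W≢V  = contradiction (⊆∧≢⇒⊂ W⊆V W≢V) W⊄V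

    factor : ∀ a b x → a * x - b * x ≡ (a - b) * x
    factor = solve-∀

    -- For an up-set V the subtraction removes the term W = V from the recursion; otherwise both
    -- sides vanish.
    ∇Ω : ∀ V z → ∇ 1ℤ (Ω V) z ≡ 𝕊 (λ W → coeff V W * Ω W (z - 1ℤ))
    ∇Ω V z = case up? V of λ where
      (no ¬up) → trans
        (cong₂ _-_ (Ω-¬Up ¬up z) (Ω-¬Up ¬up (z - 1ℤ)))
        (sym (𝕊-zero λ W → cong (_* Ω W (z - 1ℤ)) (coeff-¬Up W ¬up)))
      (yes up) → begin
        Ω V z - Ω V (z - 1ℤ)
          ≡⟨ cong₂ _-_ (Ω-Up up z) (sym (𝕊-single V (λ W → Ω W (z - 1ℤ)))) ⟩
        𝕊 (λ W → 𝟙 (W ⊆? V) * Ω W (z - 1ℤ)) - 𝕊 (λ W → 𝟙 (W ≟ˢ V) * Ω W (z - 1ℤ))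
          ≡⟨ 𝕊-minus (λ W → 𝟙 (W ⊆? V) * Ω W (z - 1ℤ)) (λ W → 𝟙 (W ≟ˢ V) * Ω W (z - 1ℤ)) ⟨
        𝕊 (λ W → 𝟙 (W ⊆? V) * Ω W (z - 1ℤ) - 𝟙 (W ≟ˢ V) * Ω W (z - 1ℤ))
          ≡⟨ 𝕊-cong (λ W → trans (factor (𝟙 (W ⊆? V)) (𝟙 (W ≟ˢ V)) (Ω W (z - 1ℤ)))
               (cong (_* Ω W (z - 1ℤ)) (sym (coeff-Up W up)))) ⟩
        𝕊 (λ W → coeff V W * Ω W (z - 1ℤ)) ∎

    ∇^Ω-suc : ∀ k V z → ∇^ (suc k) 1ℤ (Ω V) z ≡ 𝕊 (λ W → coeff V W * ∇^ k 1ℤ (Ω W) (z - 1ℤ))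
    ∇^Ω-suc k V z = begin
      ∇^ (suc k) 1ℤ (Ω V) z       ≡⟨ ∇^-∇ k 1ℤ 1ℤ (Ω V) z ⟨
      ∇^ k 1ℤ (∇ 1ℤ (Ω V)) z      ≡⟨ ∇^-cong k 1ℤ (∇Ω V) z ⟩
      ∇^ k 1ℤ (λ y → 𝕊 (λ W → coeff V W * Ω W (y - 1ℤ))) z
        ≡⟨ ∇^-𝕊 k 1ℤ (coeff V) (λ W y → Ω W (y - 1ℤ)) z ⟩
      𝕊 (λ W → coeff V W * ∇^ k 1ℤ (λ y → Ω W (y - 1ℤ)) z)
        ≡⟨ 𝕊-cong (λ W → cong (_*_ (coeff V W)) (∇^-translate k 1ℤ (Ω W) z)) ⟩
      𝕊 (λ W → coeff V W * ∇^ k 1ℤ (Ω W) (z - 1ℤ)) ∎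

    -- Both sides obey the same recursion. The argument is k because every step lowers it by one, so
    -- that it reaches 0 together with the number of differences.
    ∇^Ω-surjCount : ∀ k V → ∇^ k 1ℤ (Ω V) (+ k) ≡ surjCount k V
    ∇^Ω-surjCount zero    V = weakCount-0 V
    ∇^Ω-surjCount (suc k) V = trans (∇^Ω-suc k V (+ suc k)) (trans
      (𝕊-cong λ W → trans (cong (_*_ (coeff V W)) (∇^Ω-surjCount k W)) (*-assoc (𝟙 (W ⊆? V)) _ (surjCount k W)))
      (sym (surjCount-suc k V)))

    -- Each difference passes to proper subsets, and V is too small for k such steps.
    ∇^Ω-vanish : ∀ k V → ∣ V ∣ ℕ.< k → ∀ z → ∇^ k 1ℤ (Ω V) z ≡ 0ℤ
    ∇^Ω-vanish (suc k) V (s≤s ∣V∣≤k) z = trans (∇^Ω-suc k V z) (𝕊-zero λ W → case W ⊂? V of λ where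
      (no W⊄V)  → cong (_* ∇^ k 1ℤ (Ω W) (z - 1ℤ)) (coeff-¬⊂ W⊄V)
      (yes W⊂V) → trans
        (cong (_*_ (coeff V W)) (∇^Ω-vanish k W (ℕ.<-≤-trans (p⊂q⇒∣p∣<∣q∣ W⊂V) ∣V∣≤k) (z - 1ℤ)))
        (*-zeroʳ (coeff V W)))

    -- One further difference vanishes, so this one is constant and may be evaluated at d.
    ∇^Ω-constant : ∀ z → ∇^ d 1ℤ (Ω ⊤) z ≡ surjCount d ⊤
    ∇^Ω-constant z = trans (constant z) (trans (sym (constant (+ d))) (∇^Ω-surjCount d ⊤))
      where constant = ∇-constant (∇^ d 1ℤ (Ω ⊤)) (∇^Ω-vanish (suc d) ⊤ (s≤s (∣p∣≤n ⊤)))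

-- Graded posets

∣⁅x⁆∪p∣ : ∀ {n} {x : Fin n} {p : Subset n} → x ∉ p → ∣ ⁅ x ⁆ ∪ p ∣ ≡ suc ∣ p ∣
∣⁅x⁆∪p∣ {x = zero}  {inside  ∷ p} x∉p = contradiction here x∉p
∣⁅x⁆∪p∣ {x = zero}  {outside ∷ p} x∉p = cong (suc ∘ ∣_∣) (∪-identityˡ p)
∣⁅x⁆∪p∣ {x = suc x} {inside  ∷ p} x∉p = cong suc (∣⁅x⁆∪p∣ (x∉p ∘ there))
∣⁅x⁆∪p∣ {x = suc x} {outside ∷ p} x∉p = ∣⁅x⁆∪p∣ (x∉p ∘ there)

module Graded {ℓ} {d : ℕ} {_≼_ : Rel (Fin d) ℓ} (isPO : IsPartialOrder _≡_ _≼_) (_≼?_ : Decidable₂ _≼_) where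
  open import Data.Nat using (_+_; _∸_; _≤_; _<_)
  open Order isPO _≼?_

  Chain : Subset d → Set ℓ
  Chain S = ∀ {i j} → i ∈ S → j ∈ S → i ≼ j ⊎ j ≼ i

  MaximalChain : Subset d → Set ℓ
  MaximalChain S = Chain S × (∀ T → Chain T → S ⊆ T → T ⊆ S)

  infix 4 _⋖_
  _⋖_ : Rel (Fin d) ℓ
  i ⋖ j = i ≺ j × (∀ x → i ≼ x → x ≼ j → x ≡ i ⊎ x ≡ j)

  data Saturated : Fin d → Fin d → ℕ → Set ℓ where
    nil : ∀ {i} → Saturated i i 0
    cons : ∀ {i j k n} → i ⋖ j → Saturated j k n → Saturated i k (suc n)

  _++_ : ∀ {i j k m n} → Saturated i j m → Saturated j k n → Saturated i k (m + n)
  nil     ++ q = q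
  cons c p ++ q = cons c (p ++ q)

  members : ∀ {i j n} → Saturated i j n → Subset d
  members (nil {i})     = ⁅ i ⁆
  members (cons {i} c p) = ⁅ i ⁆ ∪ members p

  start∈ : ∀ {i j n} (p : Saturated i j n) → i ∈ members p
  start∈ {i} nil       = x∈⁅x⁆ i
  start∈ {i} (cons c p) = x∈p∪q⁺ (inj₁ (x∈⁅x⁆ i))

  start-≼ : ∀ {i j n} (p : Saturated i j n) {x} → x ∈ members p → i ≼ x
  start-≼ {i} nil       x∈ = ≼.reflexive (sym (x∈⁅y⁆⇒x≡y i x∈))
  start-≼ {i} (cons c p) x∈ with x∈p∪q⁻ ⁅ i ⁆ (members p) x∈
  ... | inj₁ x∈i = ≼.reflexive (sym (x∈⁅y⁆⇒x≡y i x∈i))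
  ... | inj₂ x∈p = ≼.trans (proj₁ (proj₁ c)) (start-≼ p x∈p)

  ∣members∣ : ∀ {i j n} (p : Saturated i j n) → ∣ members p ∣ ≡ suc n
  ∣members∣ {i} nil       = ∣⁅x⁆∣≡1 i
  ∣members∣ {i} (cons ((i≼k , i≢k) , _) p) = trans
    (∣⁅x⁆∪p∣ λ i∈p → i≢k (≼.antisym i≼k (start-≼ p i∈p)))
    (cong suc (∣members∣ p))

  members-chain : ∀ {i j n} (p : Saturated i j n) → Chain (members p)
  members-chain {i} nil x∈ y∈ = inj₁ (≼.reflexive (trans (x∈⁅y⁆⇒x≡y i x∈) (sym (x∈⁅y⁆⇒x≡y i y∈))))
  members-chain {i} q@(cons c p) x∈ y∈ with x∈p∪q⁻ ⁅ i ⁆ (members p) x∈ | x∈p∪q⁻ ⁅ i ⁆ (members p) y∈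
  ... | inj₂ x∈p | inj₂ y∈p = members-chain p x∈p y∈p
  ... | inj₁ x∈i | _        rewrite x∈⁅y⁆⇒x≡y i x∈i = inj₁ (start-≼ q y∈)
  ... | _        | inj₁ y∈i rewrite x∈⁅y⁆⇒x≡y i y∈i = inj₂ (start-≼ q x∈)

  -- Saturated chains that are maximal chains

  Minimal Maximal : Fin d → Set ℓ
  Minimal i = ∀ x → x ≼ i → x ≡ i
  Maximal i = ∀ x → i ≼ x → x ≡ i

  -- Climb the chain while x lies above the next member. If x falls below it, x sits inside a cover
  -- and must be one of its ends; at the top, maximality leaves no other choice.
  comparable⇒member : ∀ {i j n} (p : Saturated i j n) → Maximal j → ∀ {x} → i ≼ x →
    (∀ {y} → y ∈ members p → x ≼ y ⊎ y ≼ x) → x ∈ members p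
  comparable⇒member {i} nil max {x} i≼x _ rewrite max x i≼x = x∈⁅x⁆ i
  comparable⇒member {i} (cons (_ , between) p) max {x} i≼x comparable
    with comparable (x∈p∪q⁺ (inj₂ (start∈ p)))
  ... | inj₂ k≼x = x∈p∪q⁺ (inj₂ (comparable⇒member p max k≼x (λ y∈p → comparable (x∈p∪q⁺ (inj₂ y∈p)))))
  ... | inj₁ x≼k with between x i≼x x≼k
  ... | inj₁ refl = x∈p∪q⁺ (inj₁ (x∈⁅x⁆ i))
  ... | inj₂ refl = x∈p∪q⁺ (inj₂ (start∈ p))

  members-maximal : ∀ {i j n} (p : Saturated i j n) → Minimal i → Maximal j → MaximalChain (members p)
  members-maximal {i} p min max = members-chain p , λ T T-chain p⊆T {x} x∈T →
    let comparable : ∀ {y} → y ∈ members p → x ≼ y ⊎ y ≼ x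
        comparable y∈p = T-chain x∈T (p⊆T y∈p)
        i≼x : i ≼ x
        i≼x = [ (λ x≼i → ≼.reflexive (sym (min x x≼i))) , (λ i≼x → i≼x) ]′ (comparable (start∈ p))
    in comparable⇒member p max i≼x comparable

  -- A minimal element among those strictly above i and below j covers i; continue from there, which
  -- ends because the start rises strictly.
  saturate : ∀ {i j} → i ≼ j → ∃[ n ] Saturated i j n
  saturate {i} {j} = go (po-noetherian isPO i)
    where
    go : ∀ {i} → Acc _ i → i ≼ j → ∃[ n ] Saturated i j n
    go {i} (acc above) i≼j with i Fin.≟ j
    ... | yes refl = 0 , nil
    ... | no i≢j with minimal-below isPO _≼?_ (i ≺?_) (i≼j , i≢j)
    ... | k , k≼j , i≺k , min with go (above i≺k) k≼j
    ... | n , p = suc n , cons (i≺k , between) p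
      where
      between : ∀ x → i ≼ x → x ≼ k → x ≡ i ⊎ x ≡ k
      between x i≼x x≼k with i Fin.≟ x | x Fin.≟ k
      ... | yes i≡x | _       = inj₁ (sym i≡x)
      ... | no _    | yes x≡k = inj₂ x≡k
      ... | no i≢x  | no x≢k  = contradiction (i≼x , i≢x) (min x x≼k x≢k)

  -- Each cover raises the value by at least one; positivity at the start keeps strictness in force.
  strict-along : ∀ {v i j n} → Strict v → 0 < lookup v i → Saturated i j n → lookup v i + n ≤ lookup v j
  strict-along {v} {i} s 0<vᵢ nil = ℕ.≤-reflexive (ℕ.+-identityʳ (lookup v i))
  strict-along {v} {i} {j} {suc n} s 0<vᵢ (cons {j = k} (i≺k , _) p) = begin
    lookup v i + suc n   ≡⟨ ℕ.+-suc (lookup v i) n ⟩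
    suc (lookup v i) + n ≤⟨ ℕ.+-monoˡ-≤ n vᵢ<vₖ ⟩
    lookup v k + n       ≤⟨ strict-along {v} s (ℕ.<-trans 0<vᵢ vᵢ<vₖ) p ⟩
    lookup v j           ∎
    where
    open ℕ.≤-Reasoning
    vᵢ<vₖ = s i k i≺k 0<vᵢ

  descent : ∀ i → ∃[ m ] ∃[ n ] Minimal m × Saturated m i n
  descent i with minimal-below {P = λ _ → Unit.⊤} isPO _≼?_ (λ _ → yes _) {i} _
  ... | m , m≼i , _ , min = m , proj₁ (saturate m≼i) , minimal , proj₂ (saturate m≼i)
    where
    minimal : Minimal m
    minimal x x≼m with x Fin.≟ m
    ... | yes x≡m = x≡m
    ... | no  x≢m = contradiction _ (min x x≼m x≢m)

  ascent : ∀ i → ∃[ m ] ∃[ n ] Maximal m × Saturated i m n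
  ascent i with maximal-above {P = λ _ → Unit.⊤} (λ _ → yes _) {i} _
  ... | m , i≼m , _ , max = m , proj₁ (saturate i≼m) , maximal , proj₂ (saturate i≼m)
    where
    maximal : Maximal m
    maximal x m≼x with m Fin.≟ x
    ... | yes m≡x = sym m≡x
    ... | no  m≢x = contradiction _ (max x (m≼x , m≢x))

  module _ {r : ℕ} (graded : ∀ S → MaximalChain S → ∣ S ∣ ∸ 1 ≡ r) where

    saturated-length : ∀ {i j n} → Minimal i → Maximal j → Saturated i j n → n ≡ r
    saturated-length min max p = trans
      (cong (_∸ 1) (sym (∣members∣ p))) (graded (members p) (members-maximal p min max))

    -- Lengths of the chains that `descent` and `ascent` happen to choose; gradedness makes all
    -- chains with such ends equally long.
    rank corank : Fin d → ℕ
    rank   i = proj₁ (proj₂ (descent i))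
    corank i = proj₁ (proj₂ (ascent i))

    -- Extending the chain down to a minimal and up to a maximal element gives a maximal chain.
    rank+n+corank : ∀ {i j n} → Saturated i j n → rank i + (n + corank j) ≡ r
    rank+n+corank {i} {j} p =
      let (_ , _ , min , below) = descent i
          (_ , _ , max , above) = ascent j
      in saturated-length min max (below ++ (p ++ above))

    -- Compare the chain with the trivial one at j: both extend to length r with the same upper
    -- part, which cancels.
    rank-along : ∀ {i j n} → Saturated i j n → rank j ≡ rank i + n
    rank-along {i} {j} {n} p = ℕ.+-cancelʳ-≡ (corank j) (rank j) (rank i + n)
      (trans (rank+n+corank nil) (trans (sym (rank+n+corank p)) (sym (ℕ.+-assoc (rank i) n (corank j)))))

    rank-< : ∀ {i j} → i ≺ j → rank i < rank j
    rank-< {i} (i≼j , i≢j) with saturate i≼j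
    ... | zero  , nil = contradiction refl i≢j
    ... | suc n , p    = ℕ.<-≤-trans (ℕ.m<m+n (rank i) (s≤s z≤n)) (ℕ.≤-reflexive (sym (rank-along p)))

    ranks : Vec ℕ d
    ranks = tabulate rank

    lookup-ranks : ∀ i → lookup ranks i ≡ rank i
    lookup-ranks = Vec.lookup∘tabulate rank

    lookup-+ranks : ∀ u i → lookup (zipWith _+_ u ranks) i ≡ lookup u i + rank i
    lookup-+ranks u i = trans (Vec.lookup-zipWith _+_ i u ranks) (cong (_+_ (lookup u i)) (lookup-ranks i))

    -- The chain chosen below i forces the value above its rank. The chain above i forces the value
    -- plus the corank to be at most k + r, and r is rank plus corank.
    strict-bounds : ∀ {k v} → InBox ⊤ (k + r) v → Strict v → ∀ i →
      lookup ranks i < lookup v i × lookup v i ≤ lookup ranks i + k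
    strict-bounds {k} {v} (full , v≤k+r) s i rewrite lookup-ranks i =
      let (m , _ , _ , below) = descent i
          (M , b , _ , above) = ascent i
      in ℕ.≤-trans (ℕ.+-monoˡ-≤ (rank i) (v>0 m)) (strict-along {v} s (v>0 m) below) ,
         ℕ.+-cancelʳ-≤ b (lookup v i) (rank i + k) (begin
           lookup v i + b    ≤⟨ strict-along {v} s (v>0 i) above ⟩
           lookup v M        ≤⟨ v≤k+r M ⟩
           k + r             ≡⟨ cong (_+_ k) (rank+n+corank (nil {i})) ⟨
           k + (rank i + b)  ≡⟨ ℕ.+-assoc k (rank i) b ⟨
           k + rank i + b    ≡⟨ cong (_+ b) (ℕ.+-comm k (rank i)) ⟩
           rank i + k + b    ∎)
      where
      open ℕ.≤-Reasoning
      v>0 : ∀ i → 0 < lookup v i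
      v>0 i = ∈-supp⁻ v (subst (i ∈_) (sym full) ∈⊤)

    -- Along n covers the strict vector gains at least n and the rank exactly n, so their difference
    -- does not decrease.
    Strict⇒Weak : ∀ u → (∀ i → 0 < lookup u i) → Strict (zipWith _+_ u ranks) → Weak u
    Strict⇒Weak u u>0 s i j i≼j with saturate i≼j
    ... | n , p = ℕ.+-cancelʳ-≤ (rank i + n) (lookup u i) (lookup u j) (begin
      lookup u i + (rank i + n)                 ≡⟨ ℕ.+-assoc (lookup u i) (rank i) n ⟨
      lookup u i + rank i + n                   ≡⟨ cong (_+ n) (lookup-+ranks u i) ⟨
      lookup (zipWith _+_ u ranks) i + n        ≤⟨ strict-along {zipWith _+_ u ranks} s 0<uᵢ p ⟩
      lookup (zipWith _+_ u ranks) j            ≡⟨ lookup-+ranks u j ⟩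
      lookup u j + rank j                       ≡⟨ cong (_+_ (lookup u j)) (rank-along p) ⟩
      lookup u j + (rank i + n)                 ∎)
      where
      open ℕ.≤-Reasoning
      0<uᵢ : 0 < lookup (zipWith _+_ u ranks) i
      0<uᵢ = ℕ.≤-trans (u>0 i) (ℕ.≤-trans (ℕ.m≤m+n (lookup u i) (rank i)) (ℕ.≤-reflexive (sym (lookup-+ranks u i))))

    Weak⇒Strict : ∀ u → Weak u → Strict (zipWith _+_ u ranks)
    Weak⇒Strict u w i j i≺j _ rewrite lookup-+ranks u i | lookup-+ranks u j =
      ℕ.+-mono-≤-< (w i j (proj₁ i≺j)) (rank-< i≺j)

    strictCount-shift : ∀ k → strictCount (k + r) ⊤ ≡ weakCount k ⊤
    strictCount-shift k = trans
      (box-shift ranks k r _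
        -- The rank is at most r, because rank and corank add up to r.
        (λ i → ℕ.≤-trans (ℕ.≤-reflexive (lookup-ranks i))
          (ℕ.≤-trans (ℕ.m≤m+n (rank i) _) (ℕ.≤-reflexive (rank+n+corank (nil {i})))))
        (λ v v∈ i out → 𝟙-no (strict? v) λ s → out (strict-bounds v∈ s i)))
      (box-cong ⊤ k λ u (full , _) → 𝟙-cong (strict? (zipWith _+_ u ranks)) (weak? u)
        (Strict⇒Weak u λ i → ∈-supp⁻ u (subst (i ∈_) (sym full) ∈⊤))
        (Weak⇒Strict u))

-- Counting with enumerated maps

-- A section g of f is injective. If g missed x, punching x out would embed n + 1 elements into n;
-- hence g is onto and inverts f on both sides.
surjective⇒injective : ∀ {n} (f : Fin n → Fin n) → (∀ y → ∃[ x ] f x ≡ y) → Injective _≡_ _≡_ f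
surjective⇒injective {suc n} f surj {x} {y} fx≡fy =
  trans (sym (g-onto x)) (trans (cong g fx≡fy) (g-onto y))
  where
  g : Fin (suc n) → Fin (suc n)
  g y = proj₁ (surj y)
  g-injective : Injective _≡_ _≡_ g
  g-injective {a} {b} ga≡gb = trans (sym (proj₂ (surj a))) (trans (cong f ga≡gb) (proj₂ (surj b)))
  hit : ∀ x → ∃[ a ] g a ≡ x
  hit x with Fin.any? (λ a → g a Fin.≟ x)
  ... | yes a   = a
  ... | no none = contradiction
    (λ {a} {b} eq → g-injective (Fin.punchOut-injective (missed a) (missed b) eq))
    (Fin.<⇒notInjective {f = λ a → punchOut (missed a)} ℕ.≤-refl)
    where
    missed : ∀ a → x ≢ g a
    missed a x≡ga = none (a , sym x≡ga)
  g-onto : ∀ x → g (f x) ≡ x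
  g-onto x = let (a , ga≡x) = hit x in
    trans (cong (g ∘ f) (sym ga≡x)) (trans (cong g (proj₂ (surj a))) ga≡x)

module Counts {c ℓ₁ ℓ₂} (Q : FinitePoset c ℓ₁ ℓ₂) where
  open ≡-Reasoning
  open FinitePoset Q hiding (isEquivalence; isPartialOrder)

  _≼_ : Rel (Fin size) ℓ₂
  i ≼ j = element i ≤ element j

  ≼-isPartialOrder : IsPartialOrder _≡_ _≼_
  ≼-isPartialOrder = record
    { isPreorder = record
      { isEquivalence = isEquivalence
      ; reflexive     = λ { refl → reflexive Eq.refl }
      ; trans         = ≤-trans
      }
    ; antisym = λ {i} {j} i≼j j≼i →
        trans (sym (index-element i)) (trans (index-cong (antisym i≼j j≼i)) (index-element j))
    }
    where
    ≤-trans = DecPoset.trans decPoset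

  open Order ≼-isPartialOrder (λ i j → element i ≤? element j) public
  open Graded ≼-isPartialOrder (λ i j → element i ≤? element j) public

  index-mono : ∀ {x y} → x ≤ y → index x ≼ index y
  index-mono {x} {y} x≤y = ≤-respˡ-≈ (Eq.sym (element-index x)) (≤-respʳ-≈ (Eq.sym (element-index y)) x≤y)

  values : ∀ k → Fin (k ℕ.^ size) → Vec ℕ size
  values k t = tabulate (suc ∘ toℕ ∘ finToFun {k} t)

  lookup-values : ∀ k t i → lookup (values k t) i ≡ suc (toℕ (finToFun {k} t i))
  lookup-values k t = Vec.lookup∘tabulate (suc ∘ toℕ ∘ finToFun {k} t)

  -- The map that `allMaps` builds locally, repeated so that its lists can be unfolded.
  toMap : ∀ k → Fin (k ℕ.^ size) → MapToChain Q k
  toMap k t = record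
    { to   = finToFun {k} t ∘ index
    ; cong = λ x≈y → cong (finToFun {k} t) (index-cong x≈y)
    }

  monotone⇒weak : ∀ k t → OrderPreserving Q (toMap k t) → Weak (values k t)
  monotone⇒weak k t mono i j i≼j rewrite lookup-values k t i | lookup-values k t j =
    s≤s (subst₂ (λ i j → finToFun {k} t i Fin.≤ finToFun {k} t j) (index-element i) (index-element j) (mono i≼j))

  weak⇒monotone : ∀ k t → Weak (values k t) → OrderPreserving Q (toMap k t)
  weak⇒monotone k t w {x} {y} x≤y = ℕ.≤-pred
    (subst₂ ℕ._≤_ (lookup-values k t (index x)) (lookup-values k t (index y)) (w (index x) (index y) (index-mono x≤y)))

  orderPolynomial≡weakCount : ∀ k → + orderPolynomial Q k ≡ weakCount k ⊤
  orderPolynomial≡weakCount k = begin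
    + orderPolynomial Q k
      ≡⟨ length-filter-map (orderPreserving? Q) (toMap k) ⟩
    ∑[ t < k ℕ.^ size ] 𝟙 (orderPreserving? Q (toMap k t))
      ≡⟨ Sum.sum-cong-≗ {k ℕ.^ size} (λ t → 𝟙-cong (orderPreserving? Q (toMap k t)) (weak? (values k t))
           (λ mono → monotone⇒weak k t mono) (λ w → weak⇒monotone k t w)) ⟩
    ∑[ t < k ℕ.^ size ] 𝟙 (weak? (values k t))
      ≡⟨ box-finToFun size k (λ v → 𝟙 (weak? v)) ⟩
    weakCount k ⊤ ∎

  -- On d elements, surjectivity onto a chain with d elements already gives bijectivity.
  #linearExtensions≡surjCount : + #linearExtensions Q ≡ surjCount size ⊤
  #linearExtensions≡surjCount = begin
    + #linearExtensions Q
      ≡⟨ length-filter-map (isLinearExtension? Q) (toMap size) ⟩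
    ∑[ t < size ℕ.^ size ] 𝟙 (isLinearExtension? Q (toMap size t))
      ≡⟨ Sum.sum-cong-≗ {size ℕ.^ size} (λ t → 𝟙-cong (isLinearExtension? Q (toMap size t)) (surj? size (values size t))
           (λ ((_ , surjective) , mono) → monotone⇒weak size t mono , λ a →
             let (x , fx≡a) = surjective a in
             index x , trans (lookup-values size t (index x)) (cong (suc ∘ toℕ) (fx≡a Eq.refl)))
           (λ (w , onto) → bijective t onto , weak⇒monotone size t w)) ⟩
    ∑[ t < size ℕ.^ size ] 𝟙 (surj? size (values size t))
      ≡⟨ box-finToFun size size (λ v → 𝟙 (surj? size v)) ⟩
    surjCount size ⊤ ∎
    where
    bijective : ∀ t → Onto size (values size t) → Bijective _≈_ _≡_ (finToFun {size} t ∘ index)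
    bijective t onto = injective , λ a → element (proj₁ (surjective a)) , λ z≈ →
      trans (cong (finToFun {size} t) (trans (index-cong z≈) (index-element _))) (proj₂ (surjective a))
      where
      surjective : ∀ a → ∃[ i ] finToFun {size} t i ≡ a
      surjective a = let (i , vᵢ≡) = onto a in
        i , Fin.toℕ-injective (ℕ.suc-injective (trans (sym (lookup-values size t i)) vᵢ≡))
      injective : Injective _≈_ _≡_ (finToFun {size} t ∘ index)
      injective {x} {y} eq = Eq.trans (Eq.sym (element-index x)) (Eq.trans
        (Eq.reflexive (cong element (surjective⇒injective (finToFun {size} t) surjective eq)))
        (element-index y))

  module _ {r : ℕ} (graded : IsGradedOfRank Q r) where

    -- The argument is -(m (r + 2) + 1 + r), so reciprocity counts strict maps into a chain whose
    -- size exceeds m (r + 2) + 1 by exactly r, and subtracting the rank removes that excess. This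
    -- is where the step r + 2 comes from.
    Ω-reflected : ∀ m → Ω ⊤ (1ℤ ℤ.- + (suc m ℕ.* (r ℕ.+ 2))) ≡
      -1ℤ ℤ.^ size ℤ.* + orderPolynomial Q (m ℕ.* (r ℕ.+ 2) ℕ.+ 1)
    Ω-reflected m = begin
      Ω ⊤ (1ℤ ℤ.- + (suc m ℕ.* (r ℕ.+ 2)))           ≡⟨ cong (λ k → Ω ⊤ (1ℤ ℤ.- + k)) (period m r) ⟩
      σ (⊤ {size}) ℤ.* strictCount (suc (m ℕ.* (r ℕ.+ 2) ℕ.+ r)) ⊤
        ≡⟨ cong₂ (λ n k → -1ℤ ℤ.^ n ℤ.* strictCount k ⊤) (∣⊤∣≡n size) (shift (m ℕ.* (r ℕ.+ 2)) r) ⟩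
      -1ℤ ℤ.^ size ℤ.* strictCount (m ℕ.* (r ℕ.+ 2) ℕ.+ 1 ℕ.+ r) ⊤
        ≡⟨ cong (ℤ._*_ (-1ℤ ℤ.^ size)) (trans
             (strictCount-shift graded (m ℕ.* (r ℕ.+ 2) ℕ.+ 1))
             (sym (orderPolynomial≡weakCount (m ℕ.* (r ℕ.+ 2) ℕ.+ 1)))) ⟩
      -1ℤ ℤ.^ size ℤ.* + orderPolynomial Q (m ℕ.* (r ℕ.+ 2) ℕ.+ 1) ∎
      where
      period : ∀ m r → suc m ℕ.* (r ℕ.+ 2) ≡ suc (suc (m ℕ.* (r ℕ.+ 2) ℕ.+ r))
      period = solveℕ-∀
      shift : ∀ a r → suc (a ℕ.+ r) ≡ a ℕ.+ 1 ℕ.+ r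
      shift = solveℕ-∀

open import Data.Nat using (_+_; _*_)

corollary5p11 : ∀ {c ℓ₁ ℓ₂} (Q : FinitePoset c ℓ₁ ℓ₂) (r : ℕ) →
    let d = FinitePoset.size Q
        n = ⌊ d /2⌋
    in
    .{{_ : NonZero d}} →
    IsGradedOfRank Q r →
    (+ (r + 2)) ℤ.^ d ℤ.* + (#linearExtensions Q)
      ≡ ∑[ i < suc n ] (let m = toℕ i in
          -1ℤ ℤ.^ (n + m)
          ℤ.* (+ (d C (n ∸ m)) ℤ.+ -1ℤ ℤ.^ (d ∸ 1) ℤ.* + (d C (n + m + 1)))
          ℤ.* + (orderPolynomial Q (m * (r + 2) + 1)))
corollary5p11 Q r graded = begin
  (+ (r + 2)) ℤ.^ d ℤ.* + #linearExtensions Q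
    ≡⟨ cong (ℤ._*_ ((+ (r + 2)) ℤ.^ d)) #linearExtensions≡surjCount ⟩
  (+ (r + 2)) ℤ.^ d ℤ.* surjCount d ⊤
    -- The difference is constant, so the point is free. From n (r + 2) + 1 the sample points m (r +
    -- 2) + 1 run over -n - 1 ≤ m ≤ n, a range stable under m ↦ -1 - m.
    ≡⟨ ∇^-step d (Ω ⊤) (surjCount d ⊤) ∇^Ω-constant (r + 2) _ ⟨
  ∇^ d (+ (r + 2)) (Ω ⊤) (+ (⌊ d /2⌋ * (r + 2) + 1))
    ≡⟨ symmetric-difference d (r + 2) (Ω ⊤) (λ m → + orderPolynomial Q (m * (r + 2) + 1))
         (λ m → sym (orderPolynomial≡weakCount (m * (r + 2) + 1))) (Ω-reflected graded) ⟩
  _ ∎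
  where
  d = FinitePoset.size Q
  open Counts Q
  open ≡-Reasoning
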